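{- Identify $\mathbb Z^4$ with $\mathbb H(\mathbb Z)$ via $(x,y,z,t)\mapsto x+yi+zj+tk$. Let $q_1,q_2\in\mathbb H(\mathbb Z)$ be odd quaternions (i.e. $N(q_1),N(q_2)$ odd), neither of which is right-divisible in $\mathbb H(\mathbb Z)$ by a quaternion $\alpha+\beta i$ with $\alpha,\beta\in\mathbb Z$, $\alpha^2+\beta^2>1$. Let $u=q_1 j\overline{q_2}=(u_1,u_2,u_3,u_4)$ and $v=q_1k\overline{q_2}=(v_1,v_2,v_3,v_4)$. Then the area of a fundamental domain of the lattice $\mathbb Z^4\cap\operatorname{span}_{\mathbb R}(u,v)$ equals $\operatorname{lcm}(N(q_1),N(q_2))$, and the Ehrhart polynomial of the square $S$ with vertices $0,u,v,u+v$ is $$E_S(t)=\gcd(N(q_1),N(q_2))\,t^2+(D_1+D_2)\,t+1,$$ where $D_1=\gcd(u_1,u_2,u_3,u_4)$ and $D_2=\gcd(v_1,v_2,v_3,v_4)$.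
   Context: $\mathbb H(\mathbb Z)$ is the set of integer Hamilton quaternions $x+yi+zj+tk$ with $i^2=j^2=k^2=-1$, $ij=-ji=k$, $jk=-kj=i$, $ki=-ik=j$; $\overline{q}=x-yi-zj-tk$, $N(q)=x^2+y^2+z^2+t^2$. $q$ is right-divisible by $\pi$ if $q=q'\pi$ with $q'\in\mathbb H(\mathbb Z)$. The Ehrhart polynomial $E_S$ of a lattice polytope $S\subset\mathbb R^4$ satisfies $E_S(t)=\#(tS\cap\mathbb Z^4)$ for all positive integers $t$. -}

module Defs where

open import Data.Nat as ℕ using (ℕ; suc)
open import Data.Nat.GCD using (gcd)
open import Data.Integer as ℤ using (ℤ; ∣_∣)
open import Data.Rational as ℚ using (ℚ)
open import Data.Product using (Σ; ∃; _×_; _,_)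
open import Data.List using (List)
open import Data.List.Membership.Propositional using (_∈_)
open import Data.List.Relation.Unary.Unique.Propositional using (Unique)
open import Relation.Binary.PropositionalEquality using (_≡_)
open import Relation.Nullary using (¬_)

-- Integer Hamilton quaternions  x + y i + z j + t k ; also used as points of ℤ⁴
-- via (x,y,z,t) ↦ x + yi + zj + tk.
record ℍ : Set where
  constructor quat
  field
    x y z t : ℤ
open ℍ public

infixl 7 _·_
-- Hamilton product (i² = j² = k² = -1, ij = k, jk = i, ki = j)
_·_ : ℍ → ℍ → ℍ
quat a1 b1 c1 d1 · quat a2 b2 c2 d2 = quat
  (a1 ℤ.* a2 ℤ.- b1 ℤ.* b2 ℤ.- c1 ℤ.* c2 ℤ.- d1 ℤ.* d2)
  (a1 ℤ.* b2 ℤ.+ b1 ℤ.* a2 ℤ.+ c1 ℤ.* d2 ℤ.- d1 ℤ.* c2)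
  (a1 ℤ.* c2 ℤ.- b1 ℤ.* d2 ℤ.+ c1 ℤ.* a2 ℤ.+ d1 ℤ.* b2)
  (a1 ℤ.* d2 ℤ.+ b1 ℤ.* c2 ℤ.- c1 ℤ.* b2 ℤ.+ d1 ℤ.* a2)

conj : ℍ → ℍ
conj (quat a b c d) = quat a (ℤ.- b) (ℤ.- c) (ℤ.- d)

qj qk : ℍ
qj = quat (ℤ.+ 0) (ℤ.+ 0) (ℤ.+ 1) (ℤ.+ 0)
qk = quat (ℤ.+ 0) (ℤ.+ 0) (ℤ.+ 0) (ℤ.+ 1)

cplx : ℤ → ℤ → ℍ
cplx α β = quat α β (ℤ.+ 0) (ℤ.+ 0)

N : ℍ → ℕ
N (quat a b c d) = ∣ a ℤ.* a ℤ.+ b ℤ.* b ℤ.+ c ℤ.* c ℤ.+ d ℤ.* d ∣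

Odd : ℍ → Set
Odd q = ¬ (2 Data.Nat.Divisibility.∣ N q)
  where import Data.Nat.Divisibility

RightDivisible : ℍ → ℍ → Set
RightDivisible q π = Σ ℍ λ q' → q ≡ q' · π

gcd4 : ℍ → ℕ
gcd4 (quat a b c d) = gcd (gcd (gcd ∣ a ∣ ∣ b ∣) ∣ c ∣) ∣ d ∣

ι : ℤ → ℚ
ι n = n ℚ./ 1

IsComb : ℚ → ℚ → ℍ → ℍ → ℍ → Set
IsComb a b u v p =
  (ι (x p) ≡ a ℚ.* ι (x u) ℚ.+ b ℚ.* ι (x v)) ×
  (ι (y p) ≡ a ℚ.* ι (y u) ℚ.+ b ℚ.* ι (y v)) ×
  (ι (z p) ≡ a ℚ.* ι (z u) ℚ.+ b ℚ.* ι (z v)) ×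
  (ι (t p) ≡ a ℚ.* ι (t u) ℚ.+ b ℚ.* ι (t v))

InSpan : ℍ → ℍ → ℍ → Set
InSpan u v p = Σ ℚ λ a → Σ ℚ λ b → IsComb a b u v p

IntComb : ℍ → ℍ → ℍ → Set
IntComb a b p = Σ ℤ λ m → Σ ℤ λ n → IsComb (ι m) (ι n) a b p

dot : ℍ → ℍ → ℤ
dot p q = x p ℤ.* x q ℤ.+ y p ℤ.* y q ℤ.+ z p ℤ.* z q ℤ.+ t p ℤ.* t q

gram : ℍ → ℍ → ℤ
gram a b = dot a a ℤ.* dot b b ℤ.- dot a b ℤ.* dot a b

-- The lattice ℤ⁴ ∩ span(u,v) has a basis (a, b) whose fundamental
-- parallelogram has area A, i.e. Gram determinant A².
CovolumeIs : ℍ → ℍ → ℕ → Set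
CovolumeIs u v A = Σ ℍ λ a → Σ ℍ λ b →
  InSpan u v a × InSpan u v b ×
  (∀ p → InSpan u v p → IntComb a b p) ×
  gram a b ≡ ℤ.+ (A ℕ.* A)

InDilate : ℕ → ℍ → ℍ → ℍ → Set
InDilate n u v p = Σ ℚ λ a → Σ ℚ λ b →
  (ℚ.0ℚ ℚ.≤ a) × (a ℚ.≤ ι (ℤ.+ n)) × (ℚ.0ℚ ℚ.≤ b) × (b ℚ.≤ ι (ℤ.+ n)) ×
  IsComb a b u v p

CountIs : (ℍ → Set) → ℕ → Set
CountIs P c = Σ (List ℍ) λ ps →
  Unique ps × (∀ p → p ∈ ps → P p) × (∀ p → P p → p ∈ ps) ×
  Data.List.length ps ≡ c
  where import Data.List

{-# OPTIONS --safe #-}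
-- Write q = A + jB with A, B ∈ ℤ[i]. Then q has no non-unit right divisor in ℤ[i] iff A and B are
-- coprime, i.e. (ℤ[i] being Euclidean) iff some left multiple w q has complex part 1. Pairing with
-- q₁ j w₂, w̄₁ j q̄₂, w̄₁ j w₂ and the same with k in place of j shows that g = gcd(N q₁, N q₂)
-- annihilates ℤ⁴ ∩ span(u,v) modulo ⟨u,v⟩ and that the contents D₁, D₂ of u, v are coprime, while
-- v ū ∈ N(q₂) ℍ(ℤ) and v̄ u ∈ N(q₁) ℍ(ℤ) make u, v linearly dependent modulo g. Hence the quotient
-- is cyclic of order g, and the plane has a lattice basis u′, w with u = D₁ u′, v = γ u′ + h w,
-- D₁ h = g. The covolume is N(q₁) N(q₂) / g = lcm(N q₁, N q₂). On each of the h n + 1 lattice lines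
-- parallel to u that meet the n-th dilate lie n D₁ points off its far edge, and that edge, parallel
-- to v, carries n D₂ + 1 points.
module Submission where

open import Defs
open import Data.Empty using (⊥-elim)
open import Data.Fin using (#_)
open import Data.Integer as ℤ using (ℤ; +_; 0ℤ; 1ℤ; ∣_∣)
open import Data.Integer.Divisibility.Signed using (divides; ∣ᵤ⇒∣; ∣⇒∣ᵤ)
open import Data.Integer.DivMod using (_%ℕ_; _/ℕ_; n%ℕd<d; a≡a%ℕn+[a/ℕn]*n)
import Data.Integer.Properties as ℤ
open import Data.Integer.Solver using () renaming (module +-*-Solver to ℤ-Solver)
open import Data.Integer.Tactic.RingSolver using (solve-∀)
open import Data.List using (List; []; _∷_; map; _++_; length; upTo; cartesianProduct)
open import Data.List.Membership.Propositional using (_∈_)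
open import Data.List.Membership.Propositional.Properties
  using (∈-map⁺; ∈-map⁻; ∈-++⁺ˡ; ∈-++⁺ʳ; ∈-++⁻; ∈-cartesianProduct⁺; ∈-cartesianProduct⁻; ∈-upTo⁺; ∈-upTo⁻)
open import Data.List.Properties using (length-++; length-map; length-upTo)
open import Data.List.Relation.Unary.Unique.Propositional using (Unique)
open import Data.List.Relation.Unary.Unique.Propositional.Properties using (map⁺; ++⁺; cartesianProduct⁺; upTo⁺)
open import Data.Nat as ℕ using (ℕ; zero; suc)
import Data.Nat.Coprimality as Coprime
import Data.Nat.Divisibility as ℕ
open import Data.Nat.GCD using (gcd; gcd-GCD; gcd[m,n]∣m; gcd[m,n]∣n; gcd[m,n]≢0; module Bézout)
open import Data.Nat.Induction using (<-wellFounded)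
open import Data.Nat.LCM using (lcm; gcd*lcm)
import Data.Nat.Properties as ℕ
import Data.Nat.Tactic.RingSolver as ℕ
open import Data.Product using (_×_; _,_; Σ; ∃₂; proj₁; proj₂)
open import Data.Rational as ℚ using (ℚ; mkℚ; 0ℚ)
import Data.Rational.Properties as ℚ
open import Data.Rational.Solver using () renaming (module +-*-Solver to ℚ-Solver)
open import Data.Sum using (_⊎_; inj₁; inj₂; reduce)
open import Data.Vec using (Vec; []; _∷_)
open import Induction.WellFounded using (Acc; acc)
open import Relation.Binary.PropositionalEquality
open import Relation.Nullary using (¬_; yes; no)
open ≡-Reasoning

-- Every lattice fact is certified by integral functionals `dot e`: a point `a u + b v` with
-- rational a, b is controlled by pairing it with vectors whose products with u and v are known, and
-- no quotient group is formed. That the complex part of `w · q` is exactly 1 matters because j or k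
-- times an element of span(j, k) lies in span(1, i). The pairings with j and k then see only the 1,
-- and so separate u from v. Oddness of g enters twice. The pairings that use w₁ and w₂ together
-- produce only the number 2 as a combination of the contents, and this helps because g, a multiple
-- of D₁, is prime to 2. Polarisation likewise gives only twice the wanted relation between u and v.
-- The annihilator g and the dependence modulo g alone leave a functional with value D₁ on w.
-- Coprimality of the contents improves this value to 1, and that is what makes (u′, w) a basis of
-- the whole plane lattice.

-- Integer arithmetic: parity, Bézout, remainders.

module Arithmetic where
  open import Data.Integer using (_+_; _*_; -_; _-_)

  -- The witness makes `- m` an inverse of 2 modulo n. In this form oddness serves both to reach 1
  -- from 2 and to divide a vector relation by 2.
  odd⇒≡1+2* : ∀ n → ¬ 2 ℕ.∣ n → Σ ℤ λ m → + n ≡ 1ℤ + + 2 * m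
  odd⇒≡1+2* zero odd = ⊥-elim (odd (2 ℕ.∣0))
  odd⇒≡1+2* (suc zero) odd = 0ℤ , refl
  odd⇒≡1+2* (suc (suc n)) odd with odd⇒≡1+2* n (λ 2∣n → odd (ℕ.∣m∣n⇒∣m+n ℕ.∣-refl 2∣n))
  ... | m , eq = 1ℤ + m , trans (cong (_+_ (+ 2)) eq) (rearrange m)
    where
    rearrange : ∀ m → + 2 + (1ℤ + + 2 * m) ≡ 1ℤ + + 2 * (1ℤ + m)
    rearrange = solve-∀

  gcd-bézout : ∀ m n → ∃₂ λ α β → α * + m + β * + n ≡ + gcd m n
  gcd-bézout m n with Bézout.identity (gcd-GCD m n)
  ... | Bézout.Identity.+- a b eq = + a , - + b , (begin
    + a * + m + - + b * + n                    ≡⟨ cong (_+ - + b * + n) (ℤ.pos-* a m) ⟨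
    + (a ℕ.* m) + - + b * + n                  ≡⟨ cong (λ k → + k + - + b * + n) eq ⟨
    + gcd m n + + (b ℕ.* n) + - + b * + n      ≡⟨ cong (λ k → + gcd m n + k + - + b * + n) (ℤ.pos-* b n) ⟩
    + gcd m n + + b * + n + - + b * + n        ≡⟨ cancel (+ gcd m n) (+ b) (+ n) ⟩
    + gcd m n                                  ∎)
    where
    cancel : ∀ d b n → d + b * n + - b * n ≡ d
    cancel = solve-∀
  ... | Bézout.Identity.-+ a b eq = - + a , + b , (begin
    - + a * + m + + b * + n                    ≡⟨ cong (_+_ (- + a * + m)) (ℤ.pos-* b n) ⟨
    - + a * + m + + (b ℕ.* n)                  ≡⟨ cong (λ k → - + a * + m + + k) eq ⟨
    - + a * + m + (+ gcd m n + + (a ℕ.* m))    ≡⟨ cong (λ k → - + a * + m + (+ gcd m n + k)) (ℤ.pos-* a m) ⟩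
    - + a * + m + (+ gcd m n + + a * + m)      ≡⟨ cancel (+ gcd m n) (+ a) (+ m) ⟩
    + gcd m n                                  ∎)
    where
    cancel : ∀ d a m → - a * m + (d + a * m) ≡ d
    cancel = solve-∀

  0≤i*i : ∀ i → 0ℤ ℤ.≤ i * i
  0≤i*i (+ n) = subst (0ℤ ℤ.≤_) (ℤ.pos-* n n) (ℤ.+≤+ ℕ.z≤n)
  0≤i*i ℤ.-[1+ n ] = ℤ.+≤+ ℕ.z≤n

  gcd²*lcm² : ∀ m n → (+ m * + n) * (+ m * + n) ≡ + gcd m n * + gcd m n * + (lcm m n ℕ.* lcm m n)
  gcd²*lcm² m n = begin
    (+ m * + n) * (+ m * + n)                              ≡⟨ cong (λ k → k * k) mn≡ ⟩
    (+ gcd m n * + lcm m n) * (+ gcd m n * + lcm m n)      ≡⟨ interchange (+ gcd m n) (+ lcm m n) ⟩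
    + gcd m n * + gcd m n * (+ lcm m n * + lcm m n)        ≡⟨ cong (+ gcd m n * + gcd m n *_) (ℤ.pos-* (lcm m n) (lcm m n)) ⟨
    + gcd m n * + gcd m n * + (lcm m n ℕ.* lcm m n)        ∎
    where
    mn≡ : + m * + n ≡ + gcd m n * + lcm m n
    mn≡ = trans (sym (ℤ.pos-* m n)) (trans (cong +_ (sym (gcd*lcm m n))) (ℤ.pos-* (gcd m n) (lcm m n)))
    interchange : ∀ g l → (g * l) * (g * l) ≡ g * g * (l * l)
    interchange = solve-∀

  i-j+j≡i : ∀ i j → i - j + j ≡ i
  i-j+j≡i = solve-∀

  -- A remainder below h is invisible to bounds that are multiples of h: the lower bound gives 0 < h
  -- (1 + i), the upper one h i < h c. Hence a half-open segment carries the same number of points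
  -- whatever its residue.
  quotient-bounds : ∀ h ρ i c .{{_ : ℕ.NonZero h}} → ρ ℕ.< h →
    0ℤ ℤ.≤ + h * i + + ρ → + h * i + + ρ ℤ.< + h * c → 0ℤ ℤ.≤ i × i ℤ.< c
  quotient-bounds h ρ i c ρ<h nonneg bound =
    ℤ.≤-trans (ℤ.i<j⇒i≤pred[j] 0<suc) (ℤ.≤-reflexive (ℤ.pred-suc i)) ,
    ℤ.*-cancelˡ-<-nonNeg (+ h) (ℤ.≤-<-trans (ℤ.i≤i+j (+ h * i) (+ ρ)) bound)
    where
    split : ∀ h i → h * i + h ≡ h * (1ℤ + i)
    split = solve-∀
    0<suc : 0ℤ ℤ.< ℤ.suc i
    0<suc = ℤ.*-cancelˡ-<-nonNeg (+ h) (subst₂ ℤ._<_ (sym (ℤ.*-zeroʳ (+ h))) (split (+ h) i)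
      (ℤ.≤-<-trans nonneg (ℤ.+-monoʳ-< (+ h * i) (ℤ.+<+ ρ<h))))

open Arithmetic

-- Identities for quaternion product, norm and inner product.

module QuaternionAlgebra where
  open import Data.Integer using (_+_; _*_; -_; _-_)
  open ℤ-Solver using (Polynomial; _:+_; _:*_; _:-_; :-_; var; con; prove; ⟦_⟧; ⟦_⟧↓)

  infixl 6 _⊕_
  infixr 7 _•_

  _⊕_ : ℍ → ℍ → ℍ
  quat a b c d ⊕ quat a′ b′ c′ d′ = quat (a + a′) (b + b′) (c + c′) (d + d′)

  _•_ : ℤ → ℍ → ℍ
  n • quat a b c d = quat (n * a) (n * b) (n * c) (n * d)

  nsq : ℍ → ℤ
  nsq p = dot p p

  quat-≡ : ∀ {p q} → x p ≡ x q → y p ≡ y q → z p ≡ z q → t p ≡ t q → p ≡ q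
  quat-≡ refl refl refl refl = refl

  -- Mirroring the operations of ℍ on polynomial expressions makes an identity in ℍ definitionally
  -- equal to four identities in ℤ for the ring solver.
  record ℍₚ (n : ℕ) : Set where
    constructor quatₚ
    field xₚ yₚ zₚ tₚ : Polynomial n
  open ℍₚ

  infixl 7 _·ₚ_
  infixl 6 _⊕ₚ_
  infixr 7 _•ₚ_

  _·ₚ_ : ∀ {n} → ℍₚ n → ℍₚ n → ℍₚ n
  quatₚ a b c d ·ₚ quatₚ a′ b′ c′ d′ = quatₚ
    (a :* a′ :- b :* b′ :- c :* c′ :- d :* d′)
    (a :* b′ :+ b :* a′ :+ c :* d′ :- d :* c′)
    (a :* c′ :- b :* d′ :+ c :* a′ :+ d :* b′)
    (a :* d′ :+ b :* c′ :- c :* b′ :+ d :* a′)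

  _⊕ₚ_ : ∀ {n} → ℍₚ n → ℍₚ n → ℍₚ n
  quatₚ a b c d ⊕ₚ quatₚ a′ b′ c′ d′ = quatₚ (a :+ a′) (b :+ b′) (c :+ c′) (d :+ d′)

  _•ₚ_ : ∀ {n} → Polynomial n → ℍₚ n → ℍₚ n
  n •ₚ quatₚ a b c d = quatₚ (n :* a) (n :* b) (n :* c) (n :* d)

  conjₚ : ∀ {n} → ℍₚ n → ℍₚ n
  conjₚ (quatₚ a b c d) = quatₚ a (:- b) (:- c) (:- d)

  dotₚ : ∀ {n} → ℍₚ n → ℍₚ n → Polynomial n
  dotₚ p q = xₚ p :* xₚ q :+ yₚ p :* yₚ q :+ zₚ p :* zₚ q :+ tₚ p :* tₚ q

  ⟦_⟧ℍ : ∀ {n} → ℍₚ n → Vec ℤ n → ℍ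
  ⟦ quatₚ a b c d ⟧ℍ ρ = quat (⟦ a ⟧ ρ) (⟦ b ⟧ ρ) (⟦ c ⟧ ρ) (⟦ d ⟧ ρ)

  proveℍ : ∀ {n} (ρ : Vec ℤ n) (p q : ℍₚ n) →
    ⟦ xₚ p ⟧↓ ρ ≡ ⟦ xₚ q ⟧↓ ρ → ⟦ yₚ p ⟧↓ ρ ≡ ⟦ yₚ q ⟧↓ ρ →
    ⟦ zₚ p ⟧↓ ρ ≡ ⟦ zₚ q ⟧↓ ρ → ⟦ tₚ p ⟧↓ ρ ≡ ⟦ tₚ q ⟧↓ ρ →
    ⟦ p ⟧ℍ ρ ≡ ⟦ q ⟧ℍ ρ
  proveℍ ρ p q ex ey ez et =
    quat-≡ (prove ρ (xₚ p) (xₚ q) ex) (prove ρ (yₚ p) (yₚ q) ey)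
           (prove ρ (zₚ p) (zₚ q) ez) (prove ρ (tₚ p) (tₚ q) et)

  -- Two scalars and three quaternions suffice for all identities. A further scalar travels as a
  -- coordinate of a quaternion slot, and slots that an identity does not mention are filled
  -- arbitrarily.
  env : ℤ → ℤ → ℍ → ℍ → ℍ → Vec ℤ 14
  env m n (quat a b c d) (quat e f g h) (quat k l o r) =
    m ∷ n ∷ a ∷ b ∷ c ∷ d ∷ e ∷ f ∷ g ∷ h ∷ k ∷ l ∷ o ∷ r ∷ []

  mₚ nₚ : Polynomial 14
  mₚ = var (# 0)
  nₚ = var (# 1)
  pₚ qₚ rₚ : ℍₚ 14
  pₚ = quatₚ (var (# 2)) (var (# 3)) (var (# 4)) (var (# 5))
  qₚ = quatₚ (var (# 6)) (var (# 7)) (var (# 8)) (var (# 9))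
  rₚ = quatₚ (var (# 10)) (var (# 11)) (var (# 12)) (var (# 13))

  ·-assoc : ∀ p q r → p · q · r ≡ p · (q · r)
  ·-assoc p q r = proveℍ (env 0ℤ 0ℤ p q r) (pₚ ·ₚ qₚ ·ₚ rₚ) (pₚ ·ₚ (qₚ ·ₚ rₚ)) refl refl refl refl

  conj-· : ∀ p q → conj (p · q) ≡ conj q · conj p
  conj-· p q = proveℍ (env 0ℤ 0ℤ p q p) (conjₚ (pₚ ·ₚ qₚ)) (conjₚ qₚ ·ₚ conjₚ pₚ) refl refl refl refl

  conj-involutive : ∀ p → conj (conj p) ≡ p
  conj-involutive p = proveℍ (env 0ℤ 0ℤ p p p) (conjₚ (conjₚ pₚ)) pₚ refl refl refl refl

  dot-·-adjointˡ : ∀ p q r → dot (p · q) r ≡ dot q (conj p · r)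
  dot-·-adjointˡ p q r = prove (env 0ℤ 0ℤ p q r) (dotₚ (pₚ ·ₚ qₚ) rₚ) (dotₚ qₚ (conjₚ pₚ ·ₚ rₚ)) refl

  dot-·-adjointʳ : ∀ p q r → dot (p · q) r ≡ dot p (r · conj q)
  dot-·-adjointʳ p q r = prove (env 0ℤ 0ℤ p q r) (dotₚ (pₚ ·ₚ qₚ) rₚ) (dotₚ pₚ (rₚ ·ₚ conjₚ qₚ)) refl

  conj-·-· : ∀ p q → conj p · (p · q) ≡ nsq p • q
  conj-·-· p q = proveℍ (env 0ℤ 0ℤ p q p) (conjₚ pₚ ·ₚ (pₚ ·ₚ qₚ)) (dotₚ pₚ pₚ •ₚ qₚ) refl refl refl refl

  ·-·-conj : ∀ p q → q · p · conj p ≡ nsq p • q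
  ·-·-conj p q = proveℍ (env 0ℤ 0ℤ p q p) (qₚ ·ₚ pₚ ·ₚ conjₚ pₚ) (dotₚ pₚ pₚ •ₚ qₚ) refl refl refl refl

  •-·ˡ : ∀ n p q → (n • p) · q ≡ n • (p · q)
  •-·ˡ n p q = proveℍ (env n 0ℤ p q p) ((mₚ •ₚ pₚ) ·ₚ qₚ) (mₚ •ₚ (pₚ ·ₚ qₚ)) refl refl refl refl

  •-·ʳ : ∀ n p q → p · (n • q) ≡ n • (p · q)
  •-·ʳ n p q = proveℍ (env n 0ℤ p q p) (pₚ ·ₚ (mₚ •ₚ qₚ)) (mₚ •ₚ (pₚ ·ₚ qₚ)) refl refl refl refl

  •-• : ∀ m n p → m • n • p ≡ (m * n) • p
  •-• m n p = proveℍ (env m n p p p) (mₚ •ₚ nₚ •ₚ pₚ) ((mₚ :* nₚ) •ₚ pₚ) refl refl refl refl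

  dot-comm : ∀ p q → dot p q ≡ dot q p
  dot-comm p q = prove (env 0ℤ 0ℤ p q p) (dotₚ pₚ qₚ) (dotₚ qₚ pₚ) refl

  dot-• : ∀ n p q → dot p (n • q) ≡ n * dot p q
  dot-• n p q = prove (env n 0ℤ p q p) (dotₚ pₚ (mₚ •ₚ qₚ)) (mₚ :* dotₚ pₚ qₚ) refl

  -- From 2 (k·u) = k̄ u + ū k and v k̄ = 2 (k·v) - k v̄.
  polarisation : ∀ k u v →
    (v · conj u) · k ⊕ (- 1ℤ) • (k · (conj v · u)) ≡ (+ 2) • (dot k u • v ⊕ (- dot k v) • u)
  polarisation k u v = proveℍ (env 0ℤ 0ℤ k u v)
    ((rₚ ·ₚ conjₚ qₚ) ·ₚ pₚ ⊕ₚ con (- 1ℤ) •ₚ (pₚ ·ₚ (conjₚ rₚ ·ₚ qₚ)))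
    (con (+ 2) •ₚ (dotₚ pₚ qₚ •ₚ rₚ ⊕ₚ (:- dotₚ pₚ rₚ) •ₚ qₚ)) refl refl refl refl

  nsq≡N : ∀ q → nsq q ≡ + N q
  nsq≡N q = sym (ℤ.0≤i⇒+∣i∣≡i (ℤ.+-mono-≤ (ℤ.+-mono-≤ (ℤ.+-mono-≤ (0≤i*i (x q)) (0≤i*i (y q))) (0≤i*i (z q))) (0≤i*i (t q))))

  dot-•-⊕ : ∀ m n p q r → dot (m • p ⊕ n • q) r ≡ m * dot p r + n * dot q r
  dot-•-⊕ m n p q r = prove (env m n p q r) (dotₚ (mₚ •ₚ pₚ ⊕ₚ nₚ •ₚ qₚ) rₚ) (mₚ :* dotₚ pₚ rₚ :+ nₚ :* dotₚ qₚ rₚ) refl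

  -- Moving s and r across the inner product lets them multiply q₁ and q₂ from the left. With s or r
  -- a conjugate the product is a norm, with s or r a Bézout multiplier it has complex part 1, so
  -- the pairing becomes explicit.
  dot-sandwich : ∀ s a r q₁ b q₂ →
    dot (conj s · a · r) (q₁ · b · conj q₂) ≡ dot a ((s · q₁) · b · conj (r · q₂))
  dot-sandwich s a r q₁ b q₂ = begin
    dot (conj s · a · r) (q₁ · b · conj q₂)
      ≡⟨ cong (λ p → dot p (q₁ · b · conj q₂)) (·-assoc (conj s) a r) ⟩
    dot (conj s · (a · r)) (q₁ · b · conj q₂)
      ≡⟨ dot-·-adjointˡ (conj s) (a · r) (q₁ · b · conj q₂) ⟩
    dot (a · r) (conj (conj s) · (q₁ · b · conj q₂))
      ≡⟨ cong (λ p → dot (a · r) (p · (q₁ · b · conj q₂))) (conj-involutive s) ⟩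
    dot (a · r) (s · (q₁ · b · conj q₂))
      ≡⟨ dot-·-adjointʳ a r (s · (q₁ · b · conj q₂)) ⟩
    dot a (s · (q₁ · b · conj q₂) · conj r)
      ≡⟨ cong (dot a) regroup ⟩
    dot a ((s · q₁) · b · conj (r · q₂)) ∎
    where
    regroup : s · (q₁ · b · conj q₂) · conj r ≡ (s · q₁) · b · conj (r · q₂)
    regroup = begin
      s · (q₁ · b · conj q₂) · conj r    ≡⟨ cong (λ p → p · conj r) (·-assoc s (q₁ · b) (conj q₂)) ⟨
      s · (q₁ · b) · conj q₂ · conj r    ≡⟨ cong (λ p → p · conj q₂ · conj r) (·-assoc s q₁ b) ⟨
      (s · q₁) · b · conj q₂ · conj r    ≡⟨ ·-assoc ((s · q₁) · b) (conj q₂) (conj r) ⟩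
      (s · q₁) · b · (conj q₂ · conj r)  ≡⟨ cong ((s · q₁) · b ·_) (conj-· r q₂) ⟨
      (s · q₁) · b · conj (r · q₂)       ∎

  jₚ kₚ : ∀ {n} → ℍₚ n
  jₚ = quatₚ (con 0ℤ) (con 0ℤ) (con 1ℤ) (con 0ℤ)
  kₚ = quatₚ (con 0ℤ) (con 0ℤ) (con 0ℤ) (con 1ℤ)

  realₚ : ∀ {n} → Polynomial n → ℍₚ n
  realₚ a = quatₚ a (con 0ℤ) (con 0ℤ) (con 0ℤ)

  real : ℤ → ℍ
  real n = quat n 0ℤ 0ℤ 0ℤ

  -- Conjugation is an isometry that negates j and k and sends `p · b · conj q` to
  -- `- (q · b · conj p)`, so p and q may be exchanged. This and the next three identities reduce a
  -- real factor on the right to a real factor on the left.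
  dot-j-j-comm : ∀ p q → dot qj (p · qj · conj q) ≡ dot qj (q · qj · conj p)
  dot-j-j-comm p q = prove (env 0ℤ 0ℤ p q p) (dotₚ jₚ (pₚ ·ₚ jₚ ·ₚ conjₚ qₚ)) (dotₚ jₚ (qₚ ·ₚ jₚ ·ₚ conjₚ pₚ)) refl

  dot-j-k-comm : ∀ p q → dot qj (p · qk · conj q) ≡ dot qj (q · qk · conj p)
  dot-j-k-comm p q = prove (env 0ℤ 0ℤ p q p) (dotₚ jₚ (pₚ ·ₚ kₚ ·ₚ conjₚ qₚ)) (dotₚ jₚ (qₚ ·ₚ kₚ ·ₚ conjₚ pₚ)) refl

  dot-k-j-comm : ∀ p q → dot qk (p · qj · conj q) ≡ dot qk (q · qj · conj p)
  dot-k-j-comm p q = prove (env 0ℤ 0ℤ p q p) (dotₚ kₚ (pₚ ·ₚ jₚ ·ₚ conjₚ qₚ)) (dotₚ kₚ (qₚ ·ₚ jₚ ·ₚ conjₚ pₚ)) refl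

  dot-k-k-comm : ∀ p q → dot qk (p · qk · conj q) ≡ dot qk (q · qk · conj p)
  dot-k-k-comm p q = prove (env 0ℤ 0ℤ p q p) (dotₚ kₚ (pₚ ·ₚ kₚ ·ₚ conjₚ qₚ)) (dotₚ kₚ (qₚ ·ₚ kₚ ·ₚ conjₚ pₚ)) refl

  module _ (n c d : ℤ) where
    private
      ρ = env n c (real d) qj qj
      U : ℍₚ 14
      U = quatₚ (con 1ℤ) (con 0ℤ) nₚ (xₚ pₚ)
      realₘ : ℍₚ 14
      realₘ = realₚ mₚ

    -- The product of j or k with the part `c j + d k` lies in span(1, i), hence is orthogonal to j
    -- and k; only the leading 1 contributes, here and in the three identities below.
    dot-real-j-j : dot qj (real n · qj · conj (quat 1ℤ 0ℤ c d)) ≡ n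
    dot-real-j-j = prove ρ (dotₚ jₚ (realₘ ·ₚ jₚ ·ₚ conjₚ U)) mₚ refl

    dot-real-j-k : dot qj (real n · qk · conj (quat 1ℤ 0ℤ c d)) ≡ 0ℤ
    dot-real-j-k = prove ρ (dotₚ jₚ (realₘ ·ₚ kₚ ·ₚ conjₚ U)) (con 0ℤ) refl

    dot-real-k-j : dot qk (real n · qj · conj (quat 1ℤ 0ℤ c d)) ≡ 0ℤ
    dot-real-k-j = prove ρ (dotₚ kₚ (realₘ ·ₚ jₚ ·ₚ conjₚ U)) (con 0ℤ) refl

    dot-real-k-k : dot qk (real n · qk · conj (quat 1ℤ 0ℤ c d)) ≡ n
    dot-real-k-k = prove ρ (dotₚ kₚ (realₘ ·ₚ kₚ ·ₚ conjₚ U)) mₚ refl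

  -- Terms linear in the (j, k)-parts lie in span(1, i), and the quadratic terms of the two summands
  -- are opposite. What remains is the norm of j plus the norm of k.
  dot-j-j+dot-k-k : ∀ c d c′ d′ →
    dot qj (quat 1ℤ 0ℤ c d · qj · conj (quat 1ℤ 0ℤ c′ d′)) +
    dot qk (quat 1ℤ 0ℤ c d · qk · conj (quat 1ℤ 0ℤ c′ d′)) ≡ + 2
  dot-j-j+dot-k-k c d c′ d′ = prove (env c d (quat c′ d′ 0ℤ 0ℤ) qj qj)
    (dotₚ jₚ (U ·ₚ jₚ ·ₚ conjₚ V) :+ dotₚ kₚ (U ·ₚ kₚ ·ₚ conjₚ V)) (con (+ 2)) refl
    where
    U V : ℍₚ 14
    U = quatₚ (con 1ℤ) (con 0ℤ) mₚ nₚ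
    V = quatₚ (con 1ℤ) (con 0ℤ) (xₚ pₚ) (yₚ pₚ)

  conj-·-self : ∀ q → conj q · q ≡ real (nsq q)
  conj-·-self q = proveℍ (env 0ℤ 0ℤ q q q) (conjₚ pₚ ·ₚ pₚ) (realₚ (dotₚ pₚ pₚ)) refl refl refl refl

  nsq-conj : ∀ q → nsq (conj q) ≡ nsq q
  nsq-conj q = prove (env 0ℤ 0ℤ q q q) (dotₚ (conjₚ pₚ) (conjₚ pₚ)) (dotₚ pₚ pₚ) refl

  ·-conj-scaleʳ : ∀ a b c → (a · c) · conj (b · c) ≡ nsq c • (a · conj b)
  ·-conj-scaleʳ a b c = begin
    (a · c) · conj (b · c)         ≡⟨ cong ((a · c) ·_) (conj-· b c) ⟩
    (a · c) · (conj c · conj b)    ≡⟨ ·-assoc (a · c) (conj c) (conj b) ⟨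
    (a · c · conj c) · conj b      ≡⟨ cong (_· conj b) (·-·-conj c a) ⟩
    (nsq c • a) · conj b           ≡⟨ •-·ˡ (nsq c) a (conj b) ⟩
    nsq c • (a · conj b)           ∎

  conj-·-scaleˡ : ∀ a b c → conj (c · a) · (c · b) ≡ nsq c • (conj a · b)
  conj-·-scaleˡ a b c = begin
    conj (c · a) · (c · b)         ≡⟨ cong (_· (c · b)) (conj-· c a) ⟩
    (conj a · conj c) · (c · b)    ≡⟨ ·-assoc (conj a) (conj c) (c · b) ⟩
    conj a · (conj c · (c · b))    ≡⟨ cong (conj a ·_) (conj-·-· c b) ⟩
    conj a · (nsq c • b)           ≡⟨ •-·ʳ (nsq c) (conj a) b ⟩
    nsq c • (conj a · b)           ∎

  dot-·ʳ : ∀ p r q → dot (p · q) (r · q) ≡ nsq q * dot p r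
  dot-·ʳ p r q = begin
    dot (p · q) (r · q)          ≡⟨ dot-·-adjointʳ p q (r · q) ⟩
    dot p (r · q · conj q)       ≡⟨ cong (dot p) (·-·-conj q r) ⟩
    dot p (nsq q • r)            ≡⟨ dot-• (nsq q) p r ⟩
    nsq q * dot p r              ∎

  dot-·ˡ : ∀ q p r → dot (q · p) (q · r) ≡ nsq q * dot p r
  dot-·ˡ q p r = begin
    dot (q · p) (q · r)          ≡⟨ dot-·-adjointˡ q p (q · r) ⟩
    dot p (conj q · (q · r))     ≡⟨ cong (dot p) (conj-·-· q r) ⟩
    dot p (nsq q • r)            ≡⟨ dot-• (nsq q) p r ⟩
    nsq q * dot p r              ∎

  conj-• : ∀ n p → conj (n • p) ≡ n • conj p
  conj-• n p = proveℍ (env n 0ℤ p p p) (conjₚ (mₚ •ₚ pₚ)) (mₚ •ₚ conjₚ pₚ) refl refl refl refl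

  dot-⊕• : ∀ m n p q r → dot p (m • q ⊕ n • r) ≡ m * dot p q + n * dot p r
  dot-⊕• m n p q r = prove (env m n p q r) (dotₚ pₚ (mₚ •ₚ qₚ ⊕ₚ nₚ •ₚ rₚ)) (mₚ :* dotₚ pₚ qₚ :+ nₚ :* dotₚ pₚ rₚ) refl

  •-commutator : ∀ n p q r → (n • q) · p ⊕ (- 1ℤ) • (p · (n • r)) ≡ n • (q · p ⊕ (- 1ℤ) • (p · r))
  •-commutator n p q r = proveℍ (env n 0ℤ p q r)
    ((mₚ •ₚ qₚ) ·ₚ pₚ ⊕ₚ con (- 1ℤ) •ₚ (pₚ ·ₚ (mₚ •ₚ rₚ)))
    (mₚ •ₚ (qₚ ·ₚ pₚ ⊕ₚ con (- 1ℤ) •ₚ (pₚ ·ₚ rₚ))) refl refl refl refl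

  •-distrib-⊕ : ∀ h D m p q → h • (D • p ⊕ (- m) • q) ≡ (D * h) • p ⊕ (- m) • h • q
  •-distrib-⊕ h D m p q = proveℍ (env h D p q (real m))
    (mₚ •ₚ (nₚ •ₚ pₚ ⊕ₚ (:- xₚ rₚ) •ₚ qₚ)) ((nₚ :* mₚ) •ₚ pₚ ⊕ₚ (:- xₚ rₚ) •ₚ mₚ •ₚ qₚ) refl refl refl refl

  odd-•-cancel : ∀ m p → (1ℤ + + 2 * m) • p ⊕ (- m) • (+ 2) • p ≡ p
  odd-•-cancel m p = proveℍ (env m 0ℤ p p p)
    ((con 1ℤ :+ con (+ 2) :* mₚ) •ₚ pₚ ⊕ₚ (:- mₚ) •ₚ con (+ 2) •ₚ pₚ) pₚ refl refl refl refl

  ⊕-residue : ∀ n p q → q ≡ n • p ⊕ (1ℤ • q ⊕ (- n) • p)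
  ⊕-residue n p q = proveℍ (env n 0ℤ p q q) qₚ (mₚ •ₚ pₚ ⊕ₚ (con 1ℤ •ₚ qₚ ⊕ₚ (:- mₚ) •ₚ pₚ)) refl refl refl refl

  •-cancel : ∀ n .{{_ : ℤ.NonZero n}} p q → n • p ≡ n • q → p ≡ q
  •-cancel n p q eq = quat-≡
    (ℤ.*-cancelˡ-≡ n (x p) (x q) (cong x eq)) (ℤ.*-cancelˡ-≡ n (y p) (y q) (cong y eq))
    (ℤ.*-cancelˡ-≡ n (z p) (z q) (cong z eq)) (ℤ.*-cancelˡ-≡ n (t p) (t q) (cong t eq))

  dot-self-•⊕ : ∀ m n p q →
    dot (m • p ⊕ n • q) (m • p ⊕ n • q) ≡ m * m * dot p p + (+ 2) * m * n * dot p q + n * n * dot q q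
  dot-self-•⊕ m n p q = prove (env m n p q p) (dotₚ s s)
    (mₚ :* mₚ :* dotₚ pₚ pₚ :+ con (+ 2) :* mₚ :* nₚ :* dotₚ pₚ qₚ :+ nₚ :* nₚ :* dotₚ qₚ qₚ) refl
    where
    s : ℍₚ 14
    s = mₚ •ₚ pₚ ⊕ₚ nₚ •ₚ qₚ

  dot-•-• : ∀ m n p q → dot (m • p) (n • q) ≡ m * n * dot p q
  dot-•-• m n p q = prove (env m n p q p) (dotₚ (mₚ •ₚ pₚ) (nₚ •ₚ qₚ)) (mₚ :* nₚ :* dotₚ pₚ qₚ) refl

  dot-•-•⊕• : ∀ D m n p q → dot (D • p) (m • p ⊕ n • q) ≡ D * (m * dot p p + n * dot p q)
  dot-•-•⊕• D m n p q = prove (env D m p q (real n))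
    (dotₚ (mₚ •ₚ pₚ) (nₚ •ₚ pₚ ⊕ₚ xₚ rₚ •ₚ qₚ)) (mₚ :* (nₚ :* dotₚ pₚ pₚ :+ xₚ rₚ :* dotₚ pₚ qₚ)) refl

  -- The change of vectors is triangular with determinant `D * h`, and a Gram determinant scales by
  -- the square.
  gram-triangular : ∀ D γ h p q → gram (D • p) (γ • p ⊕ h • q) ≡ (D * h) * (D * h) * gram p q
  gram-triangular D γ h p q = begin
    gram (D • p) (γ • p ⊕ h • q)
      ≡⟨ cong₂ _-_ (cong₂ _*_ (dot-•-• D D p p) (dot-self-•⊕ γ h p q))
           (cong₂ _*_ (dot-•-•⊕• D γ h p q) (dot-•-•⊕• D γ h p q)) ⟩
    _ ≡⟨ determinant D γ h (dot p p) (dot p q) (dot q q) ⟩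
    (D * h) * (D * h) * gram p q ∎
    where
    determinant : ∀ D γ h P Q R →
      (D * D * P) * (γ * γ * P + (+ 2) * γ * h * Q + h * h * R)
        - D * (γ * P + h * Q) * (D * (γ * P + h * Q))
      ≡ (D * h) * (D * h) * (P * R - Q * Q)
    determinant = solve-∀

open QuaternionAlgebra

-- The content of a vector as the value of an integral functional.

module Content where
  open import Data.Integer using (_+_; _*_; -_; _-_)

  ∣i∣-multiple : ∀ i → Σ ℤ λ s → + ∣ i ∣ ≡ s * i
  ∣i∣-multiple (+ n) = 1ℤ , sym (ℤ.*-identityˡ (+ n))
  ∣i∣-multiple ℤ.-[1+ n ] = - 1ℤ , sym (ℤ.-1*i≡-i ℤ.-[1+ n ])

  gcd4-bézout : ∀ u → Σ ℍ λ k → dot k u ≡ + gcd4 u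
  gcd4-bézout (quat a b c d)
    with ∣i∣-multiple a | ∣i∣-multiple b | ∣i∣-multiple c | ∣i∣-multiple d
       | gcd-bézout ∣ a ∣ ∣ b ∣ | gcd-bézout (gcd ∣ a ∣ ∣ b ∣) ∣ c ∣ | gcd-bézout (gcd (gcd ∣ a ∣ ∣ b ∣) ∣ c ∣) ∣ d ∣
  ... | s₁ , e₁ | s₂ , e₂ | s₃ , e₃ | s₄ , e₄ | α₁ , β₁ , g₁ | α₂ , β₂ , g₂ | α₃ , β₃ , g₃ =
    quat (α₃ * (α₂ * (α₁ * s₁))) (α₃ * (α₂ * (β₁ * s₂))) (α₃ * (β₂ * s₃)) (β₃ * s₄) , (begin
      α₃ * (α₂ * (α₁ * s₁)) * a + α₃ * (α₂ * (β₁ * s₂)) * b + α₃ * (β₂ * s₃) * c + β₃ * s₄ * d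
        ≡⟨ regroup α₁ β₁ α₂ β₂ α₃ β₃ s₁ s₂ s₃ s₄ a b c d ⟩
      α₃ * (α₂ * (α₁ * (s₁ * a) + β₁ * (s₂ * b)) + β₂ * (s₃ * c)) + β₃ * (s₄ * d)
        ≡⟨ cong₂ (λ A B → α₃ * (α₂ * (α₁ * A + β₁ * B) + β₂ * (s₃ * c)) + β₃ * (s₄ * d)) e₁ e₂ ⟨
      α₃ * (α₂ * (α₁ * + ∣ a ∣ + β₁ * + ∣ b ∣) + β₂ * (s₃ * c)) + β₃ * (s₄ * d)
        ≡⟨ cong₂ (λ A C → α₃ * (α₂ * A + β₂ * C) + β₃ * (s₄ * d)) g₁ (sym e₃) ⟩
      α₃ * (α₂ * + gcd₂ + β₂ * + ∣ c ∣) + β₃ * (s₄ * d)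
        ≡⟨ cong₂ (λ A D → α₃ * A + β₃ * D) g₂ (sym e₄) ⟩
      α₃ * + gcd₃ + β₃ * + ∣ d ∣
        ≡⟨ g₃ ⟩
      + gcd4 (quat a b c d) ∎)
    where
    gcd₂ gcd₃ : ℕ
    gcd₂ = gcd ∣ a ∣ ∣ b ∣
    gcd₃ = gcd gcd₂ ∣ c ∣
    regroup : ∀ α₁ β₁ α₂ β₂ α₃ β₃ s₁ s₂ s₃ s₄ a b c d →
      α₃ * (α₂ * (α₁ * s₁)) * a + α₃ * (α₂ * (β₁ * s₂)) * b + α₃ * (β₂ * s₃) * c + β₃ * s₄ * d
      ≡ α₃ * (α₂ * (α₁ * (s₁ * a) + β₁ * (s₂ * b)) + β₂ * (s₃ * c)) + β₃ * (s₄ * d)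
    regroup = solve-∀

  gcd4-factor : ∀ u → Σ ℍ λ u′ → u ≡ (+ gcd4 u) • u′
  gcd4-factor u@(quat a b c d)
    with ∣ᵤ⇒∣ {+ gcd4 u} {a} a∣ | ∣ᵤ⇒∣ {+ gcd4 u} {b} b∣ | ∣ᵤ⇒∣ {+ gcd4 u} {c} c∣ | ∣ᵤ⇒∣ {+ gcd4 u} {d} d∣
    where
    abc∣ : gcd4 u ℕ.∣ gcd (gcd ∣ a ∣ ∣ b ∣) ∣ c ∣
    abc∣ = gcd[m,n]∣m _ ∣ d ∣
    ab∣ : gcd4 u ℕ.∣ gcd ∣ a ∣ ∣ b ∣
    ab∣ = ℕ.∣-trans abc∣ (gcd[m,n]∣m _ ∣ c ∣)
    a∣ : gcd4 u ℕ.∣ ∣ a ∣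
    a∣ = ℕ.∣-trans ab∣ (gcd[m,n]∣m ∣ a ∣ ∣ b ∣)
    b∣ : gcd4 u ℕ.∣ ∣ b ∣
    b∣ = ℕ.∣-trans ab∣ (gcd[m,n]∣n ∣ a ∣ ∣ b ∣)
    c∣ : gcd4 u ℕ.∣ ∣ c ∣
    c∣ = ℕ.∣-trans abc∣ (gcd[m,n]∣n (gcd ∣ a ∣ ∣ b ∣) ∣ c ∣)
    d∣ : gcd4 u ℕ.∣ ∣ d ∣
    d∣ = gcd[m,n]∣n (gcd (gcd ∣ a ∣ ∣ b ∣) ∣ c ∣) ∣ d ∣
  ... | divides a′ a≡ | divides b′ b≡ | divides c′ c≡ | divides d′ d≡ =
    quat a′ b′ c′ d′ , quat-≡ (trans a≡ (ℤ.*-comm a′ _)) (trans b≡ (ℤ.*-comm b′ _))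
                              (trans c≡ (ℤ.*-comm c′ _)) (trans d≡ (ℤ.*-comm d′ _))

open Content

-- Functionals and congruences attached to (u, v).

module DualFrame where
  open import Data.Integer using (_+_; _*_; -_; _-_)

  -- q = A + jB with A, B ∈ ℤ[i]; a left multiple of q with complex part 1 encodes
  -- a Bézout relation XA + YB = 1.
  ComplexPrimitive : ℍ → Set
  ComplexPrimitive q = Σ ℍ λ w → ∃₂ λ c d → w · q ≡ quat 1ℤ 0ℤ c d

  -- e / g and f / g are the coordinates of span(u,v) with respect to (u , v), so g annihilates the
  -- quotient of ℤ⁴ ∩ span(u,v) by ⟨u , v⟩; c-uv says that the contents of u and v are coprime.
  record Frame (u v : ℍ) (g : ℕ) : Set where
    field
      e f c c′ α β : ℍ
      e-u  : dot e u ≡ + g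
      e-v  : dot e v ≡ 0ℤ
      f-u  : dot f u ≡ 0ℤ
      f-v  : dot f v ≡ + g
      c-uv : dot c u + dot c′ v ≡ 1ℤ
      v-ū  : v · conj u ≡ (+ g) • α
      v̄-u  : conj v · u ≡ (+ g) • β
      odd  : Σ ℤ λ m → + g ≡ 1ℤ + + 2 * m

  frame : ∀ q₁ q₂ → Odd q₁ → ComplexPrimitive q₁ → ComplexPrimitive q₂ →
    Frame (q₁ · qj · conj q₂) (q₁ · qk · conj q₂) (gcd (N q₁) (N q₂))
  frame q₁ q₂ odd₁ primitive₁ primitive₂
    with primitive₁ | primitive₂ | gcd-bézout (N q₁) (N q₂)
       | odd⇒≡1+2* (gcd (N q₁) (N q₂)) (λ 2∣g → odd₁ (ℕ.∣-trans 2∣g (gcd[m,n]∣m (N q₁) (N q₂))))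
       | gcd[m,n]∣m (N q₁) (N q₂) | gcd[m,n]∣n (N q₁) (N q₂)
  ... | w₁ , c₁ , d₁ , w₁q₁≡U₁ | w₂ , c₂ , d₂ , w₂q₂≡U₂ | a₁ , a₂ , bézout | m , g-odd
      | ℕ.divides h₁ N₁≡h₁g | ℕ.divides h₂ N₂≡h₂g = record
    { e = dual qj
    ; f = dual qk
    -- `dual qj` has value g = 1 + 2m on u, and the values of `π qj` on u and `π qk` on v add up to
    -- 2; subtracting the latter m times leaves 1.
    ; c = 1ℤ • dual qj ⊕ - m • π qj
    ; c′ = - m • π qk
    -- In the product of v and the conjugate of u, the inner factors form `conj q₂ · q₂`, the norm N
    -- q₂ = h₂ g; for `β` the order is reversed and the inner factors form `conj q₁ · q₁`.
    ; α = + h₂ • (q₁ · qk · conj (q₁ · qj))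
    ; β = + h₁ • (conj (qk · conj q₂) · (qj · conj q₂))
    ; e-u = dual-diagonal qj qj (dot-real-j-j n₁ c₂ d₂) (trans (dot-j-j-comm U₁ (real n₂)) (dot-real-j-j n₂ c₁ d₁))
    ; e-v = dual-off-diagonal qj qk (dot-real-j-k n₁ c₂ d₂) (trans (dot-j-k-comm U₁ (real n₂)) (dot-real-j-k n₂ c₁ d₁))
    ; f-u = dual-off-diagonal qk qj (dot-real-k-j n₁ c₂ d₂) (trans (dot-k-j-comm U₁ (real n₂)) (dot-real-k-j n₂ c₁ d₁))
    ; f-v = dual-diagonal qk qk (dot-real-k-k n₁ c₂ d₂) (trans (dot-k-k-comm U₁ (real n₂)) (dot-real-k-k n₂ c₁ d₁))
    ; c-uv = c-uv
    ; odd = m , g-odd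
    ; v-ū = begin
        σ qk · conj (σ qj)                           ≡⟨ ·-conj-scaleʳ (q₁ · qk) (q₁ · qj) (conj q₂) ⟩
        nsq (conj q₂) • (q₁ · qk · conj (q₁ · qj))   ≡⟨ cong (_• (q₁ · qk · conj (q₁ · qj))) (trans (nsq-conj q₂) (nsq-factor q₂ N₂≡h₂g)) ⟩
        (+ g * + h₂) • (q₁ · qk · conj (q₁ · qj))    ≡⟨ •-• (+ g) (+ h₂) _ ⟨
        (+ g) • (+ h₂) • (q₁ · qk · conj (q₁ · qj))  ∎
    ; v̄-u = begin
        conj (σ qk) · σ qj
          ≡⟨ cong₂ (λ a b → conj a · b) (·-assoc q₁ qk (conj q₂)) (·-assoc q₁ qj (conj q₂)) ⟩
        conj (q₁ · (qk · conj q₂)) · (q₁ · (qj · conj q₂))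
          ≡⟨ conj-·-scaleˡ (qk · conj q₂) (qj · conj q₂) q₁ ⟩
        nsq q₁ • (conj (qk · conj q₂) · (qj · conj q₂))
          ≡⟨ cong (_• (conj (qk · conj q₂) · (qj · conj q₂))) (nsq-factor q₁ N₁≡h₁g) ⟩
        (+ g * + h₁) • (conj (qk · conj q₂) · (qj · conj q₂))
          ≡⟨ •-• (+ g) (+ h₁) _ ⟨
        (+ g) • (+ h₁) • (conj (qk · conj q₂) · (qj · conj q₂)) ∎
    }
    where
    σ : ℍ → ℍ
    σ a = q₁ · a · conj q₂
    g : ℕ
    g = gcd (N q₁) (N q₂)
    n₁ n₂ : ℤ
    n₁ = + N q₁
    n₂ = + N q₂
    U₁ U₂ : ℍ
    U₁ = quat 1ℤ 0ℤ c₁ d₁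
    U₂ = quat 1ℤ 0ℤ c₂ d₂

    -- The two sandwiches in `dual` detect N q₁ and N q₂, and a₁, a₂ are the Bézout coefficients
    -- that combine them to g. The double conjugate keeps the shape required by `dot-sandwich`.
    dual π : ℍ → ℍ
    dual a = a₁ • (conj (conj q₁) · a · w₂) ⊕ a₂ • (conj w₁ · a · conj q₂)
    π a = conj w₁ · a · w₂

    conj-·-self′ : ∀ q → conj q · q ≡ real (+ N q)
    conj-·-self′ q = trans (conj-·-self q) (cong real (nsq≡N q))

    dual-σ : ∀ a b → dot (dual a) (σ b) ≡
      a₁ * dot a (real n₁ · b · conj U₂) + a₂ * dot a (U₁ · b · conj (real n₂))
    dual-σ a b = trans (dot-•-⊕ a₁ a₂ (conj (conj q₁) · a · w₂) (conj w₁ · a · conj q₂) (σ b))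
      (cong₂ (λ r s → a₁ * r + a₂ * s)
        (trans (dot-sandwich (conj q₁) a w₂ q₁ b q₂)
               (cong₂ (λ p q → dot a (p · b · conj q)) (conj-·-self′ q₁) w₂q₂≡U₂))
        (trans (dot-sandwich w₁ a (conj q₂) q₁ b q₂)
               (cong₂ (λ p q → dot a (p · b · conj q)) w₁q₁≡U₁ (conj-·-self′ q₂))))

    π-σ : ∀ a b → dot (π a) (σ b) ≡ dot a (U₁ · b · conj U₂)
    π-σ a b = trans (dot-sandwich w₁ a w₂ q₁ b q₂)
      (cong₂ (λ p q → dot a (p · b · conj q)) w₁q₁≡U₁ w₂q₂≡U₂)

    dual-diagonal : ∀ a b →
      dot a (real n₁ · b · conj U₂) ≡ + N q₁ →
      dot a (U₁ · b · conj (real n₂)) ≡ + N q₂ →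
      dot (dual a) (σ b) ≡ + g
    dual-diagonal a b eq₁ eq₂ =
      trans (dual-σ a b) (trans (cong₂ (λ r s → a₁ * r + a₂ * s) eq₁ eq₂) bézout)

    dual-off-diagonal : ∀ a b →
      dot a (real n₁ · b · conj U₂) ≡ 0ℤ →
      dot a (U₁ · b · conj (real n₂)) ≡ 0ℤ →
      dot (dual a) (σ b) ≡ 0ℤ
    dual-off-diagonal a b eq₁ eq₂ =
      trans (dual-σ a b) (trans (cong₂ (λ r s → a₁ * r + a₂ * s) eq₁ eq₂)
        (cong₂ _+_ (ℤ.*-zeroʳ a₁) (ℤ.*-zeroʳ a₂)))

    c-uv : dot (1ℤ • dual qj ⊕ - m • π qj) (σ qj) + dot (- m • π qk) (σ qk) ≡ 1ℤ
    c-uv = begin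
      dot (1ℤ • dual qj ⊕ - m • π qj) (σ qj) + dot (- m • π qk) (σ qk)
        ≡⟨ cong₂ _+_ (dot-•-⊕ 1ℤ (- m) (dual qj) (π qj) (σ qj))
             (trans (dot-comm (- m • π qk) (σ qk)) (trans (dot-• (- m) (σ qk) (π qk)) (cong (- m *_) (dot-comm (σ qk) (π qk))))) ⟩
      1ℤ * dot (dual qj) (σ qj) + - m * dot (π qj) (σ qj) + - m * dot (π qk) (σ qk)
        ≡⟨ factor m (dot (dual qj) (σ qj)) (dot (π qj) (σ qj)) (dot (π qk) (σ qk)) ⟩
      dot (dual qj) (σ qj) + - m * (dot (π qj) (σ qj) + dot (π qk) (σ qk))
        ≡⟨ cong₂ (λ r s → r + - m * s)
             (trans (dual-diagonal qj qj (dot-real-j-j n₁ c₂ d₂) (trans (dot-j-j-comm U₁ (real n₂)) (dot-real-j-j n₂ c₁ d₁))) g-odd)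
             (trans (cong₂ _+_ (π-σ qj qj) (π-σ qk qk)) (dot-j-j+dot-k-k c₁ d₁ c₂ d₂)) ⟩
      1ℤ + + 2 * m + - m * + 2
        ≡⟨ collapse m ⟩
      1ℤ ∎
      where
      factor : ∀ m r s s′ → 1ℤ * r + - m * s + - m * s′ ≡ r + - m * (s + s′)
      factor = solve-∀
      collapse : ∀ m → 1ℤ + + 2 * m + - m * + 2 ≡ 1ℤ
      collapse = solve-∀

    nsq-factor : ∀ q {h} → N q ≡ h ℕ.* g → nsq q ≡ + g * + h
    nsq-factor q {h} eq = trans (nsq≡N q) (trans (cong +_ (trans eq (ℕ.*-comm h g))) (ℤ.pos-* g h))

open DualFrame

-- Euclidean algorithm in the Gaussian integers and complex right divisors.

module GaussianIntegers where
  open import Data.Integer using (_+_; _*_; -_; _-_)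

  ℤ[i] : Set
  ℤ[i] = ℤ × ℤ

  infixl 6 _⊞_
  infixl 7 _⊠_
  _⊞_ _⊠_ : ℤ[i] → ℤ[i] → ℤ[i]
  (a , b) ⊞ (c , d) = a + c , b + d
  (a , b) ⊠ (c , d) = a * c - b * d , a * d + b * c

  ⊟_ : ℤ[i] → ℤ[i]
  ⊟ (a , b) = - a , - b

  norm : ℤ[i] → ℤ
  norm (a , b) = a * a + b * b

  -- 4r² = n² - ρ(2n - ρ), where ρ = 2r + n is the remainder of 2a + n modulo 2n.
  round-division : ∀ a n .{{_ : ℕ.NonZero n}} →
    ∃₂ λ q r → a ≡ q * + n + r × Σ ℕ λ κ → + 4 * (r * r) + + κ ≡ + n * + n
  round-division a n@(suc _) = q , a - q * + n , split a q (+ n) , ρ ℕ.* (2 ℕ.* n ℕ.∸ ρ) , (begin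
    + 4 * (r * r) + + (ρ ℕ.* (2 ℕ.* n ℕ.∸ ρ))         ≡⟨ cong (_+_ (+ 4 * (r * r))) (trans (ℤ.pos-* ρ _) (cong (+ ρ *_) co-ρ)) ⟩
    + 4 * (r * r) + + ρ * (+ 2 * + n - + ρ)           ≡⟨ cong (λ s → + 4 * (r * r) + s * (+ 2 * + n - s)) ρ≡ ⟩
    + 4 * (r * r) + (+ 2 * a + + n - q * (+ 2 * + n)) * (+ 2 * + n - (+ 2 * a + + n - q * (+ 2 * + n)))
                                                      ≡⟨ square a q (+ n) ⟩
    + n * + n                                         ∎)
    where
    q : ℤ
    q = (+ 2 * a + + n) /ℕ (2 ℕ.* n)
    r : ℤ
    r = a - q * + n
    ρ : ℕ
    ρ = (+ 2 * a + + n) %ℕ (2 ℕ.* n)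
    co-ρ : + (2 ℕ.* n ℕ.∸ ρ) ≡ + 2 * + n - + ρ
    co-ρ = trans (sym (ℤ.⊖-≥ (ℕ.<⇒≤ (n%ℕd<d (+ 2 * a + + n) (2 ℕ.* n)))))
      (trans (sym (ℤ.m-n≡m⊖n (2 ℕ.* n) ρ)) (cong (_- + ρ) (ℤ.pos-* 2 n)))
    move : ∀ s ρ q m → s ≡ ρ + q * m → ρ ≡ s - q * m
    move s ρ q m refl = cancel ρ (q * m)
      where
      cancel : ∀ ρ k → ρ ≡ ρ + k - k
      cancel = solve-∀
    ρ≡ : + ρ ≡ + 2 * a + + n - q * (+ 2 * + n)
    ρ≡ = trans (move (+ 2 * a + + n) (+ ρ) q (+ (2 ℕ.* n)) (a≡a%ℕn+[a/ℕn]*n (+ 2 * a + + n) (2 ℕ.* n)))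
      (cong (λ m → + 2 * a + + n - q * m) (ℤ.pos-* 2 n))
    split : ∀ a q n → a ≡ q * n + (a - q * n)
    split = solve-∀
    square : ∀ a q n → + 4 * ((a - q * n) * (a - q * n)) + (+ 2 * a + n - q * (+ 2 * n)) * (+ 2 * n - (+ 2 * a + n - q * (+ 2 * n))) ≡ n * n
    square = solve-∀

  norm≡∣norm∣ : ∀ A → norm A ≡ + ∣ norm A ∣
  norm≡∣norm∣ (a , b) = sym (ℤ.0≤i⇒+∣i∣≡i (ℤ.+-mono-≤ (0≤i*i a) (0≤i*i b)))

  -- Two roundings, each with 4 r² at most n², bound R n by n² / 2; `κ` is their total slack, kept
  -- as a number so that the bounds add as equations.
  4Rn+κ≡2nn⇒R<n : ∀ R n κ .{{_ : ℕ.NonZero n}} →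
    + 4 * (+ R * + n) + + κ ≡ + 2 * (+ n * + n) → R ℕ.< n
  4Rn+κ≡2nn⇒R<n R n κ eq = ℕ.*-cancelʳ-< (4 ℕ.* n) R n (subst (ℕ._< n ℕ.* (4 ℕ.* n)) (rotate R) strict)
    where
    eqℕ : 4 ℕ.* (R ℕ.* n) ℕ.+ κ ≡ 2 ℕ.* (n ℕ.* n)
    eqℕ = ℤ.+-injective (begin
      + (4 ℕ.* (R ℕ.* n)) + + κ    ≡⟨ cong (_+ + κ) (trans (ℤ.pos-* 4 (R ℕ.* n)) (cong (+ 4 *_) (ℤ.pos-* R n))) ⟩
      + 4 * (+ R * + n) + + κ      ≡⟨ eq ⟩
      + 2 * (+ n * + n)            ≡⟨ cong (+ 2 *_) (ℤ.pos-* n n) ⟨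
      + 2 * + (n ℕ.* n)            ≡⟨ ℤ.pos-* 2 (n ℕ.* n) ⟨
      + (2 ℕ.* (n ℕ.* n))          ∎)
    rotate : ∀ m → 4 ℕ.* (m ℕ.* n) ≡ m ℕ.* (4 ℕ.* n)
    rotate m = trans (sym (ℕ.*-assoc 4 m n)) (trans (cong (ℕ._* n) (ℕ.*-comm 4 m)) (ℕ.*-assoc m 4 n))
    strict : 4 ℕ.* (R ℕ.* n) ℕ.< n ℕ.* (4 ℕ.* n)
    strict = ℕ.≤-<-trans (ℕ.m+n≤o⇒m≤o (4 ℕ.* (R ℕ.* n)) (ℕ.≤-reflexive eqℕ))
      (subst (2 ℕ.* (n ℕ.* n) ℕ.<_) (rotate n)
        (ℕ.*-monoˡ-< (n ℕ.* n) {{ℕ.m*n≢0 n n}} {2} {4} (ℕ.s≤s (ℕ.s≤s (ℕ.s≤s ℕ.z≤n)))))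

  -- Both coordinates of A times the conjugate of B are rounded to multiples of n = norm B. The
  -- remainder times the conjugate of B is then r + r′ i, whence norm(A - Q B) n = r² + r′².
  euclidean-division : ∀ A B .{{_ : ℕ.NonZero ∣ norm B ∣}} →
    Σ ℤ[i] λ Q → ∣ norm (A ⊞ ⊟ (Q ⊠ B)) ∣ ℕ.< ∣ norm B ∣
  euclidean-division A@(a , b) B@(c , d)
    with round-division (a * c + b * d) ∣ norm B ∣ | round-division (b * c - a * d) ∣ norm B ∣
  ... | q , r , s≡ , κ , bound | q′ , r′ , s′≡ , κ′ , bound′ =
    (q , q′) , 4Rn+κ≡2nn⇒R<n R n (κ ℕ.+ κ′) total
    where
    n R : ℕ
    n = ∣ norm B ∣
    R = ∣ norm (A ⊞ ⊟ ((q , q′) ⊠ B)) ∣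
    remainder : ∀ s q r n → s ≡ q * n + r → r ≡ s - q * n
    remainder s q r n refl = cancel (q * n) r
      where
      cancel : ∀ k r → r ≡ k + r - k
      cancel = solve-∀
    total : + 4 * (+ R * + n) + + (κ ℕ.+ κ′) ≡ + 2 * (+ n * + n)
    total = begin
      + 4 * (+ R * + n) + + (κ ℕ.+ κ′)
        ≡⟨ cong₂ (λ k l → + 4 * (k * l) + + (κ ℕ.+ κ′)) (norm≡∣norm∣ (A ⊞ ⊟ ((q , q′) ⊠ B))) (norm≡∣norm∣ B) ⟨
      + 4 * (norm (A ⊞ ⊟ ((q , q′) ⊠ B)) * norm B) + (+ κ + + κ′)
        ≡⟨ cong (λ k → + 4 * k + (+ κ + + κ′)) (multiplicative a b c d q q′) ⟩
      + 4 * ((a * c + b * d - q * norm B) * (a * c + b * d - q * norm B)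
        + (b * c - a * d - q′ * norm B) * (b * c - a * d - q′ * norm B)) + (+ κ + + κ′)
        ≡⟨ cong₂ (λ k l → + 4 * (k * k + l * l) + (+ κ + + κ′)) (sym r≡) (sym r′≡) ⟩
      + 4 * (r * r + r′ * r′) + (+ κ + + κ′)
        ≡⟨ regroup r r′ (+ κ) (+ κ′) ⟩
      (+ 4 * (r * r) + + κ) + (+ 4 * (r′ * r′) + + κ′)
        ≡⟨ cong₂ _+_ bound bound′ ⟩
      + n * + n + + n * + n
        ≡⟨ double (+ n * + n) ⟩
      + 2 * (+ n * + n) ∎
      where
      r≡ : r ≡ a * c + b * d - q * norm B
      r≡ = trans (remainder _ q r (+ n) s≡) (cong (λ k → a * c + b * d - q * k) (sym (norm≡∣norm∣ B)))
      r′≡ : r′ ≡ b * c - a * d - q′ * norm B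
      r′≡ = trans (remainder _ q′ r′ (+ n) s′≡) (cong (λ k → b * c - a * d - q′ * k) (sym (norm≡∣norm∣ B)))
      regroup : ∀ r r′ κ κ′ → + 4 * (r * r + r′ * r′) + (κ + κ′) ≡ (+ 4 * (r * r) + κ) + (+ 4 * (r′ * r′) + κ′)
      regroup = solve-∀
      double : ∀ k → k + k ≡ + 2 * k
      double = solve-∀
      multiplicative : ∀ a b c d q q′ →
        ((a + - (q * c - q′ * d)) * (a + - (q * c - q′ * d)) + (b + - (q * d + q′ * c)) * (b + - (q * d + q′ * c)))
          * (c * c + d * d)
        ≡ (a * c + b * d - q * (c * c + d * d)) * (a * c + b * d - q * (c * c + d * d))
          + (b * c - a * d - q′ * (c * c + d * d)) * (b * c - a * d - q′ * (c * c + d * d))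
      multiplicative = solve-∀

  -- Both halves are needed later: the cofactors turn G into a right divisor of the quaternion, the
  -- combination supplies its left multiplier.
  record BézoutIdentity (A B : ℤ[i]) : Set where
    field
      G A′ B′ X Y : ℤ[i]
      A≡ : A ≡ A′ ⊠ G
      B≡ : B ≡ B′ ⊠ G
      G≡ : X ⊠ A ⊞ Y ⊠ B ≡ G

  pair-≡ : {A B : ℤ[i]} → proj₁ A ≡ proj₁ B → proj₂ A ≡ proj₂ B → A ≡ B
  pair-≡ refl refl = refl

  norm≡0⇒≡0 : ∀ A → ∣ norm A ∣ ≡ 0 → A ≡ (0ℤ , 0ℤ)
  norm≡0⇒≡0 (a , b) eq = pair-≡ (zero-square a a*a≡0) (zero-square b b*b≡0)
    where
    sum≡0 : a * a + b * b ≡ 0ℤ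
    sum≡0 = ℤ.∣i∣≡0⇒i≡0 eq
    sumℕ≡0 : ∣ a * a ∣ ℕ.+ ∣ b * b ∣ ≡ 0
    sumℕ≡0 = ℤ.+-injective (trans (cong₂ _+_ (ℤ.0≤i⇒+∣i∣≡i (0≤i*i a)) (ℤ.0≤i⇒+∣i∣≡i (0≤i*i b))) sum≡0)
    a*a≡0 : ∣ a * a ∣ ≡ 0
    a*a≡0 = ℕ.m+n≡0⇒m≡0 _ sumℕ≡0
    b*b≡0 : ∣ b * b ∣ ≡ 0
    b*b≡0 = ℕ.m+n≡0⇒n≡0 ∣ a * a ∣ sumℕ≡0
    zero-square : ∀ i → ∣ i * i ∣ ≡ 0 → i ≡ 0ℤ
    zero-square i eq = reduce (ℤ.i*j≡0⇒i≡0∨j≡0 i (ℤ.∣i∣≡0⇒i≡0 eq))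

  bézout-base : ∀ A → BézoutIdentity A (0ℤ , 0ℤ)
  bézout-base A@(a , b) = record
    { G = A ; A′ = 1ℤ , 0ℤ ; B′ = 0ℤ , 0ℤ ; X = 1ℤ , 0ℤ ; Y = 0ℤ , 0ℤ
    ; A≡ = pair-≡ (one a b) (one′ a b)
    ; B≡ = refl
    ; G≡ = pair-≡ (fst a b) (snd a b)
    }
    where
    one : ∀ a b → a ≡ 1ℤ * a - 0ℤ * b
    one = solve-∀
    one′ : ∀ a b → b ≡ 1ℤ * b + 0ℤ * a
    one′ = solve-∀
    fst : ∀ a b → 1ℤ * a - 0ℤ * b + (0ℤ * 0ℤ - 0ℤ * 0ℤ) ≡ a
    fst = solve-∀
    snd : ∀ a b → 1ℤ * b + 0ℤ * a + (0ℤ * 0ℤ + 0ℤ * 0ℤ) ≡ b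
    snd = solve-∀

  bézout-step : ∀ A B Q → BézoutIdentity B (A ⊞ ⊟ (Q ⊠ B)) → BézoutIdentity A B
  bézout-step A@(a , b) B@(c , d) Q@(q , q′) identity = record
    { G = G ; A′ = B′ ⊞ Q ⊠ A′ ; B′ = A′ ; X = Y ; Y = X ⊞ ⊟ (Y ⊠ Q)
    ; A≡ = trans (trans (reassemble a b c d q q′) (cong₂ (λ R C → R ⊞ Q ⊠ C) B≡ A≡))
             (distribute (proj₁ B′) (proj₂ B′) q q′ (proj₁ A′) (proj₂ A′) (proj₁ G) (proj₂ G))
    ; B≡ = A≡
    ; G≡ = trans (rewind a b c d q q′ (proj₁ X) (proj₂ X) (proj₁ Y) (proj₂ Y)) G≡
    }
    where
    open BézoutIdentity identity
    reassemble : ∀ a b c d q q′ → (a , b) ≡ ((a , b) ⊞ ⊟ ((q , q′) ⊠ (c , d))) ⊞ (q , q′) ⊠ (c , d)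
    reassemble a b c d q q′ = pair-≡ (fst a (q * c - q′ * d)) (fst b (q * d + q′ * c))
      where
      fst : ∀ a k → a ≡ a + - k + k
      fst = solve-∀
    distribute : ∀ r r′ q q′ b b′ g g′ →
      (r , r′) ⊠ (g , g′) ⊞ (q , q′) ⊠ ((b , b′) ⊠ (g , g′)) ≡ ((r , r′) ⊞ (q , q′) ⊠ (b , b′)) ⊠ (g , g′)
    distribute r r′ q q′ b b′ g g′ = pair-≡ (fst r r′ q q′ b b′ g g′) (snd r r′ q q′ b b′ g g′)
      where
      fst : ∀ r r′ q q′ b b′ g g′ → r * g - r′ * g′ + (q * (b * g - b′ * g′) - q′ * (b * g′ + b′ * g))
        ≡ (r + (q * b - q′ * b′)) * g - (r′ + (q * b′ + q′ * b)) * g′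
      fst = solve-∀
      snd : ∀ r r′ q q′ b b′ g g′ → r * g′ + r′ * g + (q * (b * g′ + b′ * g) + q′ * (b * g - b′ * g′))
        ≡ (r + (q * b - q′ * b′)) * g′ + (r′ + (q * b′ + q′ * b)) * g
      snd = solve-∀
    rewind : ∀ a b c d q q′ x x′ y y′ →
      (y , y′) ⊠ (a , b) ⊞ ((x , x′) ⊞ ⊟ ((y , y′) ⊠ (q , q′))) ⊠ (c , d)
        ≡ (x , x′) ⊠ (c , d) ⊞ (y , y′) ⊠ ((a , b) ⊞ ⊟ ((q , q′) ⊠ (c , d)))
    rewind a b c d q q′ x x′ y y′ = pair-≡ (fst a b c d q q′ x x′ y y′) (snd a b c d q q′ x x′ y y′)
      where
      fst : ∀ a b c d q q′ x x′ y y′ →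
        y * a - y′ * b + ((x + - (y * q - y′ * q′)) * c - (x′ + - (y * q′ + y′ * q)) * d)
        ≡ x * c - x′ * d + (y * (a + - (q * c - q′ * d)) - y′ * (b + - (q * d + q′ * c)))
      fst = solve-∀
      snd : ∀ a b c d q q′ x x′ y y′ →
        y * b + y′ * a + ((x + - (y * q - y′ * q′)) * d + (x′ + - (y * q′ + y′ * q)) * c)
        ≡ x * d + x′ * c + (y * (b + - (q * d + q′ * c)) + y′ * (a + - (q * c - q′ * d)))
      snd = solve-∀

  gaussian-bézout : ∀ A B → Acc ℕ._<_ ∣ norm B ∣ → BézoutIdentity A B
  gaussian-bézout A B (acc rec) with ∣ norm B ∣ ℕ.≟ 0
  ... | yes normB≡0 = subst (BézoutIdentity A) (sym (norm≡0⇒≡0 B normB≡0)) (bézout-base A)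
  ... | no normB≢0 =
    let Q , smaller = euclidean-division A B {{ℕ.≢-nonZero normB≢0}}
    in bézout-step A B Q (gaussian-bézout B (A ⊞ ⊟ (Q ⊠ B)) (rec smaller))

  ≯1⇒≡0∨≡1 : ∀ n → ¬ (+ 1 ℤ.< + n) → n ≡ 0 ⊎ n ≡ 1
  ≯1⇒≡0∨≡1 0 _ = inj₁ refl
  ≯1⇒≡0∨≡1 1 _ = inj₂ refl
  ≯1⇒≡0∨≡1 (suc (suc n)) n≯1 = ⊥-elim (n≯1 (ℤ.+<+ (ℕ.s≤s (ℕ.s≤s ℕ.z≤n))))

  -- The gcd G of the two complex components is a right divisor of q, so its norm is 0 or 1. Norm 0
  -- would make q zero, hence of even norm; a unit G is cleared by its conjugate.
  complexPrimitive : ∀ q → Odd q →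
    (∀ α β → + 1 ℤ.< α * α + β * β → ¬ RightDivisible q (cplx α β)) → ComplexPrimitive q
  complexPrimitive q@(quat a b c d) odd indivisible = unit-or-zero (≯1⇒≡0∨≡1 ∣ norm G ∣ norm≯1)
    where
    -- The sign comes from ji = -k: j (c - d i) = c j + d k.
    open BézoutIdentity (gaussian-bézout (a , b) (c , - d) (<-wellFounded _))

    α β a′ b′ c′ d′ x₁ x₂ y₁ y₂ : ℤ
    α = proj₁ G
    β = proj₂ G
    a′ = proj₁ A′
    b′ = proj₂ A′
    c′ = proj₁ B′
    d′ = proj₂ B′
    x₁ = proj₁ X
    x₂ = proj₂ X
    y₁ = proj₁ Y
    y₂ = proj₂ Y

    divisible : RightDivisible q (cplx α β)
    divisible = quat a′ b′ c′ (- d′) , quat-≡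
      (trans (cong proj₁ A≡) (xx a′ b′ c′ d′ α β))
      (trans (cong proj₂ A≡) (yy a′ b′ c′ d′ α β))
      (trans (cong proj₁ B≡) (zz a′ b′ c′ d′ α β))
      (trans (trans (sym (ℤ.neg-involutive d)) (cong (λ B → - proj₂ B) B≡)) (tt a′ b′ c′ d′ α β))
      where
      xx : ∀ a b c d α β → a * α - b * β ≡ a * α - b * β - c * 0ℤ - - d * 0ℤ
      xx = solve-∀
      yy : ∀ a b c d α β → a * β + b * α ≡ a * β + b * α + c * 0ℤ - - d * 0ℤ
      yy = solve-∀
      zz : ∀ a b c d α β → c * α - d * β ≡ a * 0ℤ - b * 0ℤ + c * α + - d * β
      zz = solve-∀
      tt : ∀ a b c d α β → - (c * β + d * α) ≡ a * 0ℤ + b * 0ℤ - c * β + - d * α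
      tt = solve-∀

    norm≯1 : ¬ (+ 1 ℤ.< + ∣ norm G ∣)
    norm≯1 1<norm = indivisible α β (subst (+ 1 ℤ.<_) (sym (norm≡∣norm∣ G)) 1<norm) divisible

    unit-or-zero : ∣ norm G ∣ ≡ 0 ⊎ ∣ norm G ∣ ≡ 1 → ComplexPrimitive q
    unit-or-zero (inj₁ norm≡0) = ⊥-elim (odd (subst (2 ℕ.∣_) (sym N≡0) (2 ℕ.∣0)))
      where
      π≡0 : cplx α β ≡ cplx 0ℤ 0ℤ
      π≡0 = cong (λ π → cplx (proj₁ π) (proj₂ π)) (norm≡0⇒≡0 G norm≡0)
      q≡0 : q ≡ quat 0ℤ 0ℤ 0ℤ 0ℤ
      q≡0 = trans (proj₂ divisible) (trans (cong (quat a′ b′ c′ (- d′) ·_) π≡0)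
        (quat-≡ (null a′ b′ c′ (- d′)) (null′ a′ b′ c′ (- d′)) (null″ a′ b′ c′ (- d′)) (null‴ a′ b′ c′ (- d′))))
        where
        null : ∀ a b c d → a * 0ℤ - b * 0ℤ - c * 0ℤ - d * 0ℤ ≡ 0ℤ
        null = solve-∀
        null′ : ∀ a b c d → a * 0ℤ + b * 0ℤ + c * 0ℤ - d * 0ℤ ≡ 0ℤ
        null′ = solve-∀
        null″ : ∀ a b c d → a * 0ℤ - b * 0ℤ + c * 0ℤ + d * 0ℤ ≡ 0ℤ
        null″ = solve-∀
        null‴ : ∀ a b c d → a * 0ℤ + b * 0ℤ - c * 0ℤ + d * 0ℤ ≡ 0ℤ
        null‴ = solve-∀
      N≡0 : N q ≡ 0
      N≡0 = cong N q≡0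
    unit-or-zero (inj₂ norm≡1) = w , z (w · q) , t (w · q) , quat-≡ real-part imaginary-part refl refl
      where
      -- w = Ḡ (X - Y j) where X A + Y B = G and Ḡ G = 1.
      w : ℍ
      w = quat (α * x₁ + β * x₂) (α * x₂ - β * x₁) (- (α * y₁ + β * y₂)) (- (α * y₂ - β * y₁))
      Re Im : ℤ
      Re = proj₁ (X ⊠ (a , b) ⊞ Y ⊠ (c , - d))
      Im = proj₂ (X ⊠ (a , b) ⊞ Y ⊠ (c , - d))
      real-part : x (w · q) ≡ 1ℤ
      real-part = begin
        x (w · q)          ≡⟨ expand a b c d α β x₁ x₂ y₁ y₂ ⟩
        α * Re + β * Im    ≡⟨ cong (λ H → α * proj₁ H + β * proj₂ H) G≡ ⟩
        α * α + β * β      ≡⟨ norm≡∣norm∣ G ⟩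
        + ∣ norm G ∣       ≡⟨ cong +_ norm≡1 ⟩
        1ℤ                 ∎
        where
        expand : ∀ a b c d α β x₁ x₂ y₁ y₂ →
          (α * x₁ + β * x₂) * a - (α * x₂ - β * x₁) * b - - (α * y₁ + β * y₂) * c - - (α * y₂ - β * y₁) * d
          ≡ α * (x₁ * a - x₂ * b + (y₁ * c - y₂ * - d)) + β * (x₁ * b + x₂ * a + (y₁ * - d + y₂ * c))
        expand = solve-∀
      imaginary-part : y (w · q) ≡ 0ℤ
      imaginary-part = begin
        y (w · q)          ≡⟨ expand a b c d α β x₁ x₂ y₁ y₂ ⟩
        α * Im - β * Re    ≡⟨ cong (λ H → α * proj₂ H - β * proj₁ H) G≡ ⟩
        α * β - β * α      ≡⟨ cancel α β ⟩
        0ℤ                 ∎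
        where
        expand : ∀ a b c d α β x₁ x₂ y₁ y₂ →
          (α * x₁ + β * x₂) * b + (α * x₂ - β * x₁) * a + - (α * y₁ + β * y₂) * d - - (α * y₂ - β * y₁) * c
          ≡ α * (x₁ * b + x₂ * a + (y₁ * - d + y₂ * c)) - β * (x₁ * a - x₂ * b + (y₁ * c - y₂ * - d))
        expand = solve-∀
        cancel : ∀ α β → α * β - β * α ≡ 0ℤ
        cancel = solve-∀

open GaussianIntegers

-- A lattice basis in which u and v are triangular.

module TriangularBasis where
  open import Data.Integer using (_+_; _*_; -_; _-_)

  -- The dual functionals k, k′ give integral coordinates to every point of ℤ⁴ ∩ span(u,v), so
  -- (u′ , w) is a basis of that lattice.
  record AdaptedBasis (u v : ℍ) (D h : ℕ) : Set where
    field
      u′ w k k′ : ℍ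
      γ    : ℤ
      u≡   : u ≡ (+ D) • u′
      v≡   : v ≡ γ • u′ ⊕ (+ h) • w
      k-u′ : dot k u′ ≡ 1ℤ
      k-w  : dot k w ≡ 0ℤ
      k′-u′ : dot k′ u′ ≡ 0ℤ
      k′-w : dot k′ w ≡ 1ℤ

  module _ {u v g} (frame : Frame u v g) (D h : ℕ) .{{_ : ℕ.NonZero D}} .{{_ : ℕ.NonZero h}}
           (g≡Dh : g ≡ D ℕ.* h) (k u′ : ℍ) (k-u : dot k u ≡ + D) (u≡ : u ≡ (+ D) • u′) where
    open Frame frame

    private
      m : ℤ
      m = proj₁ odd

      dot-u : ∀ p → dot p u ≡ + D * dot p u′
      dot-u p = trans (cong (dot p) u≡) (dot-• (+ D) p u′)

      +g≡Dh : + g ≡ + D * + h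
      +g≡Dh = trans (cong +_ g≡Dh) (ℤ.pos-* D h)

      e-u′ : dot e u′ ≡ + h
      e-u′ = ℤ.*-cancelˡ-≡ (+ D) (dot e u′) (+ h) (trans (sym (dot-u e)) (trans e-u +g≡Dh))

      f-u′ : dot f u′ ≡ 0ℤ
      f-u′ = ℤ.*-cancelˡ-≡ (+ D) (dot f u′) 0ℤ (trans (sym (dot-u f)) (trans f-u (sym (ℤ.*-zeroʳ (+ D)))))

      k-u′ : dot k u′ ≡ 1ℤ
      k-u′ = ℤ.*-cancelˡ-≡ (+ D) (dot k u′) 1ℤ (trans (sym (dot-u k)) (trans k-u (sym (ℤ.*-identityʳ (+ D)))))

      γ : ℤ
      γ = dot k v

      -- Cancelling D turns divisibility by g = D h into divisibility by h, the factor that is to be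
      -- extracted from v modulo u′.
      v-ū′ : v · conj u′ ≡ (+ h) • α
      v-ū′ = •-cancel (+ D) (v · conj u′) ((+ h) • α) (begin
        (+ D) • (v · conj u′)      ≡⟨ •-·ʳ (+ D) v (conj u′) ⟨
        v · ((+ D) • conj u′)      ≡⟨ cong (v ·_) (conj-• (+ D) u′) ⟨
        v · conj ((+ D) • u′)      ≡⟨ cong (λ p → v · conj p) u≡ ⟨
        v · conj u                 ≡⟨ v-ū ⟩
        (+ g) • α                  ≡⟨ cong (_• α) +g≡Dh ⟩
        (+ D * + h) • α            ≡⟨ •-• (+ D) (+ h) α ⟨
        (+ D) • (+ h) • α          ∎)

      v̄-u′ : conj v · u′ ≡ (+ h) • β
      v̄-u′ = •-cancel (+ D) (conj v · u′) ((+ h) • β) (begin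
        (+ D) • (conj v · u′)      ≡⟨ •-·ʳ (+ D) (conj v) u′ ⟨
        conj v · ((+ D) • u′)      ≡⟨ cong (conj v ·_) u≡ ⟨
        conj v · u                 ≡⟨ v̄-u ⟩
        (+ g) • β                  ≡⟨ cong (_• β) +g≡Dh ⟩
        (+ D * + h) • β            ≡⟨ •-• (+ D) (+ h) β ⟨
        (+ D) • (+ h) • β          ∎)

      residue ζ w : ℍ
      -- The coefficient 1 stands for `dot k u′`, so that `polarisation` applies to this expression
      -- as written.
      residue = 1ℤ • v ⊕ (- γ) • u′
      ζ = α · k ⊕ (- 1ℤ) • (k · β)
      w = (+ D) • residue ⊕ (- m) • ζ

      -- Polarisation expresses twice the residue through v times the conjugate of u′ and the
      -- conjugate of v times u′, and both are multiples of h.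
      2residue : (+ 2) • residue ≡ (+ h) • ζ
      2residue = begin
        (+ 2) • (1ℤ • v ⊕ (- γ) • u′)                       ≡⟨ cong (λ n → (+ 2) • (n • v ⊕ (- γ) • u′)) k-u′ ⟨
        (+ 2) • (dot k u′ • v ⊕ (- γ) • u′)                 ≡⟨ polarisation k u′ v ⟨
        (v · conj u′) · k ⊕ (- 1ℤ) • (k · (conj v · u′))    ≡⟨ cong₂ (λ p q → p · k ⊕ (- 1ℤ) • (k · q)) v-ū′ v̄-u′ ⟩
        ((+ h) • α) · k ⊕ (- 1ℤ) • (k · ((+ h) • β))        ≡⟨ •-commutator (+ h) k α β ⟩
        (+ h) • ζ                                           ∎

      -- As g = D h = 1 + 2m, the relation 2 residue = h ζ gives residue = g residue - 2m residue ∈ h ℍ(ℤ).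
      h•w : (+ h) • w ≡ residue
      h•w = begin
        (+ h) • w
          ≡⟨ •-distrib-⊕ (+ h) (+ D) m residue ζ ⟩
        (+ D * + h) • residue ⊕ (- m) • (+ h) • ζ
          ≡⟨ cong (λ p → (+ D * + h) • residue ⊕ (- m) • p) 2residue ⟨
        (+ D * + h) • residue ⊕ (- m) • (+ 2) • residue
          ≡⟨ cong (λ n → n • residue ⊕ (- m) • (+ 2) • residue) (trans (sym +g≡Dh) (proj₂ odd)) ⟩
        (1ℤ + + 2 * m) • residue ⊕ (- m) • (+ 2) • residue
          ≡⟨ odd-•-cancel m residue ⟩
        residue ∎

      v≡ : v ≡ γ • u′ ⊕ (+ h) • w
      v≡ = trans (⊕-residue γ u′ v) (cong (γ • u′ ⊕_) (sym h•w))

      dot-v : ∀ p → dot p v ≡ γ * dot p u′ + + h * dot p w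
      dot-v p = trans (cong (dot p) v≡) (dot-⊕• γ (+ h) p u′ w)

      k-w : dot k w ≡ 0ℤ
      k-w = ℤ.*-cancelˡ-≡ (+ h) (dot k w) 0ℤ (trans (solve-for γ (+ h) (dot k u′) (dot k w) (dot-v k))
        (trans (cong (λ n → γ - γ * n) k-u′) (vanish γ (+ h))))
        where
        solve-for : ∀ γ h a b → γ ≡ γ * a + h * b → h * b ≡ γ - γ * a
        solve-for γ h a b eq = trans (cancel (γ * a) (h * b)) (cong (_- γ * a) (sym eq))
          where
          cancel : ∀ k l → l ≡ k + l - k
          cancel = solve-∀
        vanish : ∀ γ h → γ - γ * 1ℤ ≡ h * 0ℤ
        vanish = solve-∀

      f-w : dot f w ≡ + D
      f-w = ℤ.*-cancelˡ-≡ (+ h) (dot f w) (+ D) (begin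
        + h * dot f w                   ≡⟨ drop γ (+ h * dot f w) ⟩
        γ * 0ℤ + + h * dot f w          ≡⟨ cong (λ n → γ * n + + h * dot f w) f-u′ ⟨
        γ * dot f u′ + + h * dot f w    ≡⟨ dot-v f ⟨
        dot f v                         ≡⟨ trans f-v +g≡Dh ⟩
        + D * + h                       ≡⟨ ℤ.*-comm (+ D) (+ h) ⟩
        + h * + D                       ∎)
        where
        drop : ∀ γ k → k ≡ γ * 0ℤ + k
        drop = solve-∀

      e-w : dot e w ≡ - γ
      e-w = ℤ.*-cancelˡ-≡ (+ h) (dot e w) (- γ) (begin
        + h * dot e w                                ≡⟨ shift γ (+ h) (dot e w) ⟩
        γ * + h + + h * dot e w + + h * - γ          ≡⟨ cong (λ n → γ * n + + h * dot e w + + h * - γ) e-u′ ⟨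
        γ * dot e u′ + + h * dot e w + + h * - γ     ≡⟨ cong (_+ + h * - γ) (dot-v e) ⟨
        dot e v + + h * - γ                          ≡⟨ cong (_+ + h * - γ) e-v ⟩
        0ℤ + + h * - γ                               ≡⟨ ℤ.+-identityˡ (+ h * - γ) ⟩
        + h * - γ                                    ∎)
        where
        shift : ∀ γ h k → h * k ≡ γ * h + h * k + h * - γ
        shift = solve-∀

      -- If g p = s u + r v with s = e·p, r = f·p, then r = r (c·u + c′·v) is divisible by D, and
      -- k′·p = r / D.
      k′ : ℍ
      k′ = dot c u′ • f ⊕ 1ℤ • ((+ h) • c′ ⊕ (- dot c′ u′) • e)

      dot-k′ : ∀ p → dot k′ p ≡ dot c u′ * dot f p + 1ℤ * (+ h * dot c′ p + - dot c′ u′ * dot e p)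
      dot-k′ p = trans (dot-•-⊕ (dot c u′) 1ℤ f ((+ h) • c′ ⊕ (- dot c′ u′) • e) p)
        (cong (λ n → dot c u′ * dot f p + 1ℤ * n) (dot-•-⊕ (+ h) (- dot c′ u′) c′ e p))

      k′-u′ : dot k′ u′ ≡ 0ℤ
      k′-u′ = trans (dot-k′ u′) (trans (cong₂ (λ m n → dot c u′ * m + 1ℤ * (+ h * dot c′ u′ + - dot c′ u′ * n)) f-u′ e-u′)
        (vanish (dot c u′) (+ h) (dot c′ u′)))
        where
        vanish : ∀ a h b → a * 0ℤ + 1ℤ * (h * b + - b * h) ≡ 0ℤ
        vanish = solve-∀

      k′-w : dot k′ w ≡ 1ℤ
      k′-w = begin
        dot k′ w
          ≡⟨ dot-k′ w ⟩
        dot c u′ * dot f w + 1ℤ * (+ h * dot c′ w + - dot c′ u′ * dot e w)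
          ≡⟨ cong₂ (λ m n → dot c u′ * m + 1ℤ * (+ h * dot c′ w + - dot c′ u′ * n)) f-w e-w ⟩
        dot c u′ * + D + 1ℤ * (+ h * dot c′ w + - dot c′ u′ * - γ)
          ≡⟨ regroup (dot c u′) (+ D) (+ h) (dot c′ w) (dot c′ u′) γ ⟩
        + D * dot c u′ + (γ * dot c′ u′ + + h * dot c′ w)
          ≡⟨ cong₂ _+_ (dot-u c) (dot-v c′) ⟨
        dot c u + dot c′ v
          ≡⟨ c-uv ⟩
        1ℤ ∎
        where
        regroup : ∀ a D h b c γ → a * D + 1ℤ * (h * b + - c * - γ) ≡ D * a + (γ * c + h * b)
        regroup = solve-∀

    adaptedBasis : AdaptedBasis u v D h
    adaptedBasis = record
      { u′ = u′ ; w = w ; k = k ; k′ = k′ ; γ = γ ; u≡ = u≡ ; v≡ = v≡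
      ; k-u′ = k-u′ ; k-w = k-w ; k′-u′ = k′-u′ ; k′-w = k′-w }

  frame⇒adaptedBasis : ∀ {u v g} .{{_ : ℕ.NonZero g}} → Frame u v g →
    Σ ℕ λ h → ℕ.NonZero (gcd4 u) × ℕ.NonZero h × g ≡ gcd4 u ℕ.* h × AdaptedBasis u v (gcd4 u) h
  frame⇒adaptedBasis {u} {v} {g} frame =
    h , D≢0 , h≢0 , g≡Dh , adaptedBasis frame D h {{D≢0}} {{h≢0}} g≡Dh k u′ k-u u≡
    where
    open Frame frame using (e; e-u)
    D : ℕ
    D = gcd4 u
    k u′ : ℍ
    k = proj₁ (gcd4-bézout u)
    u′ = proj₁ (gcd4-factor u)
    k-u : dot k u ≡ + D
    k-u = proj₂ (gcd4-bézout u)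
    u≡ : u ≡ (+ D) • u′
    u≡ = proj₂ (gcd4-factor u)
    D∣g : D ℕ.∣ g
    -- The functional `dot e` takes the value g on u, which is D times an integral vector.
    D∣g = ∣⇒∣ᵤ (divides (dot e u′) (trans (sym e-u)
      (trans (trans (cong (dot e) u≡) (dot-• (+ D) e u′)) (ℤ.*-comm (+ D) (dot e u′)))))
    h : ℕ
    h = ℕ.quotient D∣g
    g≡Dh : g ≡ D ℕ.* h
    g≡Dh = trans (ℕ._∣_.equality D∣g) (ℕ.*-comm h D)
    Dh≢0 : ℕ.NonZero (D ℕ.* h)
    Dh≢0 = subst (λ n → ℕ.NonZero n) g≡Dh (ℕ.≢-nonZero (ℕ.≢-nonZero⁻¹ g))
    D≢0 : ℕ.NonZero D
    D≢0 = ℕ.m*n≢0⇒m≢0 D {{Dh≢0}}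
    h≢0 : ℕ.NonZero h
    h≢0 = ℕ.m*n≢0⇒n≢0 D {{Dh≢0}}

open TriangularBasis

-- Rational coefficients and integral coordinates.

module RationalSpan where
  -- The embedding `ι` normalises by a gcd and does not reduce on a variable; this is the same
  -- rational already in lowest terms, so that numerator, sum, product and order can be read off.
  fraction : ℤ → ℚ
  fraction i = mkℚ i 0 (Coprime.sym (Coprime.1-coprimeTo ∣ i ∣))

  ι≡fraction : ∀ i → ι i ≡ fraction i
  ι≡fraction i = ℚ.fromℚᵘ-toℚᵘ (fraction i)

  ι-injective : ∀ {i j} → ι i ≡ ι j → i ≡ j
  ι-injective {i} {j} eq = cong ℚ.↥_ (trans (sym (ι≡fraction i)) (trans eq (ι≡fraction j)))

  ι-+ : ∀ i j → ι (i ℤ.+ j) ≡ ι i ℚ.+ ι j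
  ι-+ i j = sym (trans (cong₂ ℚ._+_ (ι≡fraction i) (ι≡fraction j))
    (cong₂ (λ k l → ι (k ℤ.+ l)) (ℤ.*-identityʳ i) (ℤ.*-identityʳ j)))

  ι-* : ∀ i j → ι (i ℤ.* j) ≡ ι i ℚ.* ι j
  ι-* i j = sym (cong₂ ℚ._*_ (ι≡fraction i) (ι≡fraction j))

  ι-neg : ∀ i → ι (ℤ.- i) ≡ ℚ.- ι i
  ι-neg i = trans (ι≡fraction (ℤ.- i)) (trans (neg i) (cong ℚ.-_ (sym (ι≡fraction i))))
    where
    neg : ∀ i → fraction (ℤ.- i) ≡ ℚ.- fraction i
    neg (+ zero) = refl
    neg (+ suc n) = refl
    neg ℤ.-[1+ n ] = refl

  ι-mono-≤ : ∀ {i j} → i ℤ.≤ j → ι i ℚ.≤ ι j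
  ι-mono-≤ {i} {j} i≤j = subst₂ ℚ._≤_ (sym (ι≡fraction i)) (sym (ι≡fraction j))
    (ℚ.*≤* (subst₂ ℤ._≤_ (sym (ℤ.*-identityʳ i)) (sym (ℤ.*-identityʳ j)) i≤j))

  ι-cancel-≤ : ∀ {i j} → ι i ℚ.≤ ι j → i ℤ.≤ j
  ι-cancel-≤ {i} {j} ιi≤ιj with subst₂ ℚ._≤_ (ι≡fraction i) (ι≡fraction j) ιi≤ιj
  ... | ℚ.*≤* i≤j = subst₂ ℤ._≤_ (ℤ.*-identityʳ i) (ℤ.*-identityʳ j) i≤j

  ι-positive : ∀ n .{{_ : ℕ.NonZero n}} → ℚ.Positive (ι (+ n))
  ι-positive (suc n) = subst ℚ.Positive (sym (ι≡fraction (+ suc n))) _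

  ι-inverse : ∀ n .{{_ : ℕ.NonZero n}} → Σ ℚ λ r → r ℚ.* ι (+ n) ≡ ι 1ℤ
  ι-inverse n = (ℚ.1/ ι (+ n)) {{ι≢0}} , ℚ.*-inverseˡ (ι (+ n)) {{ι≢0}}
    where
    ι≢0 : ℚ.NonZero (ι (+ n))
    ι≢0 = ℚ.pos⇒nonZero (ι (+ n)) {{ι-positive n}}

  module _ {a : ℚ} {s : ℤ} (n c : ℕ) .{{_ : ℕ.NonZero c}} (scaled : a ℚ.* ι (+ c) ≡ ι s) where
    private
      instance
        ιc>0 : ℚ.Positive (ι (+ c))
        ιc>0 = ι-positive c
        ιc≥0 : ℚ.NonNegative (ι (+ c))
        ιc≥0 = ℚ.pos⇒nonNeg (ι (+ c))

      0*ιc : 0ℚ ℚ.* ι (+ c) ≡ ι 0ℤ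
      0*ιc = ℚ.*-zeroˡ (ι (+ c))

      ιn*ιc : ι (+ n) ℚ.* ι (+ c) ≡ ι (+ n ℤ.* + c)
      ιn*ιc = sym (ι-* (+ n) (+ c))

    -- With c = h for the coefficient of v and c = D h for that of u, membership in a dilate becomes
    -- a set of integer inequalities.
    clear-denominator : 0ℚ ℚ.≤ a → a ℚ.≤ ι (+ n) → 0ℤ ℤ.≤ s × s ℤ.≤ + n ℤ.* + c
    clear-denominator 0≤a a≤n =
      ι-cancel-≤ (subst₂ ℚ._≤_ 0*ιc scaled (ℚ.*-monoʳ-≤-nonNeg (ι (+ c)) 0≤a)) ,
      ι-cancel-≤ (subst₂ ℚ._≤_ scaled ιn*ιc (ℚ.*-monoʳ-≤-nonNeg (ι (+ c)) a≤n))

    restore-denominator : 0ℤ ℤ.≤ s → s ℤ.≤ + n ℤ.* + c → 0ℚ ℚ.≤ a × a ℚ.≤ ι (+ n)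
    restore-denominator 0≤s s≤nc =
      ℚ.*-cancelʳ-≤-pos (ι (+ c)) (subst₂ ℚ._≤_ (sym 0*ιc) (sym scaled) (ι-mono-≤ 0≤s)) ,
      ℚ.*-cancelʳ-≤-pos (ι (+ c)) (subst₂ ℚ._≤_ (sym scaled) (sym ιn*ιc) (ι-mono-≤ s≤nc))

  -- Integral functionals commute with rational combinations; this is the bridge from rational
  -- coefficients to integers.
  dot-isComb : ∀ {a b u v p} → IsComb a b u v p → ∀ e →
    ι (dot e p) ≡ a ℚ.* ι (dot e u) ℚ.+ b ℚ.* ι (dot e v)
  dot-isComb {a} {b} {u} {v} {p} (ex , ey , ez , et) e = begin
    ι (dot e p)
      ≡⟨ ι-dot e p ⟩
    ι (x e) ℚ.* ι (x p) ℚ.+ ι (y e) ℚ.* ι (y p) ℚ.+ ι (z e) ℚ.* ι (z p) ℚ.+ ι (t e) ℚ.* ι (t p)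
      ≡⟨ cong₂ (λ m n → ι (x e) ℚ.* m ℚ.+ ι (y e) ℚ.* n ℚ.+ ι (z e) ℚ.* ι (z p) ℚ.+ ι (t e) ℚ.* ι (t p)) ex ey ⟩
    ι (x e) ℚ.* (a ℚ.* ι (x u) ℚ.+ b ℚ.* ι (x v)) ℚ.+ ι (y e) ℚ.* (a ℚ.* ι (y u) ℚ.+ b ℚ.* ι (y v))
      ℚ.+ ι (z e) ℚ.* ι (z p) ℚ.+ ι (t e) ℚ.* ι (t p)
      ≡⟨ cong₂ (λ m n → ι (x e) ℚ.* (a ℚ.* ι (x u) ℚ.+ b ℚ.* ι (x v)) ℚ.+ ι (y e) ℚ.* (a ℚ.* ι (y u) ℚ.+ b ℚ.* ι (y v))
                   ℚ.+ ι (z e) ℚ.* m ℚ.+ ι (t e) ℚ.* n) ez et ⟩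
    ι (x e) ℚ.* (a ℚ.* ι (x u) ℚ.+ b ℚ.* ι (x v)) ℚ.+ ι (y e) ℚ.* (a ℚ.* ι (y u) ℚ.+ b ℚ.* ι (y v))
      ℚ.+ ι (z e) ℚ.* (a ℚ.* ι (z u) ℚ.+ b ℚ.* ι (z v)) ℚ.+ ι (t e) ℚ.* (a ℚ.* ι (t u) ℚ.+ b ℚ.* ι (t v))
      ≡⟨ regroup a b (ι (x e)) (ι (y e)) (ι (z e)) (ι (t e)) (ι (x u)) (ι (y u)) (ι (z u)) (ι (t u))
           (ι (x v)) (ι (y v)) (ι (z v)) (ι (t v)) ⟩
    a ℚ.* (ι (x e) ℚ.* ι (x u) ℚ.+ ι (y e) ℚ.* ι (y u) ℚ.+ ι (z e) ℚ.* ι (z u) ℚ.+ ι (t e) ℚ.* ι (t u))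
      ℚ.+ b ℚ.* (ι (x e) ℚ.* ι (x v) ℚ.+ ι (y e) ℚ.* ι (y v) ℚ.+ ι (z e) ℚ.* ι (z v) ℚ.+ ι (t e) ℚ.* ι (t v))
      ≡⟨ cong₂ (λ m n → a ℚ.* m ℚ.+ b ℚ.* n) (ι-dot e u) (ι-dot e v) ⟨
    a ℚ.* ι (dot e u) ℚ.+ b ℚ.* ι (dot e v) ∎
    where
    ι-dot : ∀ e p → ι (dot e p) ≡
      ι (x e) ℚ.* ι (x p) ℚ.+ ι (y e) ℚ.* ι (y p) ℚ.+ ι (z e) ℚ.* ι (z p) ℚ.+ ι (t e) ℚ.* ι (t p)
    ι-dot (quat a b c d) (quat a′ b′ c′ d′) =
      trans (ι-+ (a ℤ.* a′ ℤ.+ b ℤ.* b′ ℤ.+ c ℤ.* c′) (d ℤ.* d′))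
        (cong₂ ℚ._+_ (trans (ι-+ (a ℤ.* a′ ℤ.+ b ℤ.* b′) (c ℤ.* c′))
          (cong₂ ℚ._+_ (trans (ι-+ (a ℤ.* a′) (b ℤ.* b′)) (cong₂ ℚ._+_ (ι-* a a′) (ι-* b b′))) (ι-* c c′))) (ι-* d d′))
    regroup : ∀ a b e₁ e₂ e₃ e₄ u₁ u₂ u₃ u₄ v₁ v₂ v₃ v₄ →
      e₁ ℚ.* (a ℚ.* u₁ ℚ.+ b ℚ.* v₁) ℚ.+ e₂ ℚ.* (a ℚ.* u₂ ℚ.+ b ℚ.* v₂)
        ℚ.+ e₃ ℚ.* (a ℚ.* u₃ ℚ.+ b ℚ.* v₃) ℚ.+ e₄ ℚ.* (a ℚ.* u₄ ℚ.+ b ℚ.* v₄)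
      ≡ a ℚ.* (e₁ ℚ.* u₁ ℚ.+ e₂ ℚ.* u₂ ℚ.+ e₃ ℚ.* u₃ ℚ.+ e₄ ℚ.* u₄)
        ℚ.+ b ℚ.* (e₁ ℚ.* v₁ ℚ.+ e₂ ℚ.* v₂ ℚ.+ e₃ ℚ.* v₃ ℚ.+ e₄ ℚ.* v₄)
    regroup = solve 14 (λ a b e₁ e₂ e₃ e₄ u₁ u₂ u₃ u₄ v₁ v₂ v₃ v₄ →
      e₁ :* (a :* u₁ :+ b :* v₁) :+ e₂ :* (a :* u₂ :+ b :* v₂)
        :+ e₃ :* (a :* u₃ :+ b :* v₃) :+ e₄ :* (a :* u₄ :+ b :* v₄)
      := a :* (e₁ :* u₁ :+ e₂ :* u₂ :+ e₃ :* u₃ :+ e₄ :* u₄)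
        :+ b :* (e₁ :* v₁ :+ e₂ :* v₂ :+ e₃ :* v₃ :+ e₄ :* v₄)) refl
      where open ℚ-Solver

  isComb-functional : ∀ {a b u v p q} → IsComb a b u v p → IsComb a b u v q → p ≡ q
  isComb-functional (ex , ey , ez , et) (ex′ , ey′ , ez′ , et′) = quat-≡
    (ι-injective (trans ex (sym ex′))) (ι-injective (trans ey (sym ey′)))
    (ι-injective (trans ez (sym ez′))) (ι-injective (trans et (sym et′)))

  ι-linear : ∀ m n i j → ι (m ℤ.* i ℤ.+ n ℤ.* j) ≡ ι m ℚ.* ι i ℚ.+ ι n ℚ.* ι j
  ι-linear m n i j = trans (ι-+ (m ℤ.* i) (n ℤ.* j)) (cong₂ ℚ._+_ (ι-* m i) (ι-* n j))

  isComb-⊕ : ∀ m n p q → IsComb (ι m) (ι n) p q (m • p ⊕ n • q)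
  isComb-⊕ m n p q = ι-linear m n (x p) (x q) , ι-linear m n (y p) (y q) , ι-linear m n (z p) (z q) , ι-linear m n (t p) (t q)

  module Plane {u v : ℍ} {D h : ℕ} .{{_ : ℕ.NonZero D}} .{{_ : ℕ.NonZero h}} (basis : AdaptedBasis u v D h) where
    open AdaptedBasis basis public

    point : ℤ → ℤ → ℍ
    point m l = m • u′ ⊕ l • w

    dot-k-point : ∀ m l → dot k (point m l) ≡ m
    dot-k-point m l = trans (dot-⊕• m l k u′ w) (trans (cong₂ (λ i j → m ℤ.* i ℤ.+ l ℤ.* j) k-u′ k-w) (unit m l))
      where
      unit : ∀ m l → m ℤ.* 1ℤ ℤ.+ l ℤ.* 0ℤ ≡ m
      unit = solve-∀

    dot-k′-point : ∀ m l → dot k′ (point m l) ≡ l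
    dot-k′-point m l = trans (dot-⊕• m l k′ u′ w) (trans (cong₂ (λ i j → m ℤ.* i ℤ.+ l ℤ.* j) k′-u′ k′-w) (unit m l))
      where
      unit : ∀ m l → m ℤ.* 0ℤ ℤ.+ l ℤ.* 1ℤ ≡ l
      unit = solve-∀

    u≡point : u ≡ point (+ D) 0ℤ
    u≡point = trans u≡ (pad (+ D) u′ w)
      where
      open ℤ-Solver using (con)
      pad : ∀ n p q → n • p ≡ n • p ⊕ 0ℤ • q
      pad n p q = proveℍ (env n 0ℤ p q p) (mₚ •ₚ pₚ) (mₚ •ₚ pₚ ⊕ₚ con 0ℤ •ₚ qₚ) refl refl refl refl

    isComb-point : ∀ a b m l → a ℚ.* ι (+ D) ℚ.+ b ℚ.* ι γ ≡ ι m → b ℚ.* ι (+ h) ≡ ι l →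
      IsComb a b u v (point m l)
    isComb-point a b m l am bl = subst₂ (λ u v → IsComb a b u v (point m l)) (sym u≡) (sym v≡)
      (coordinate (x u′) (x w) , coordinate (y u′) (y w) , coordinate (z u′) (z w) , coordinate (t u′) (t w))
      where
      coordinate : ∀ i j → ι (m ℤ.* i ℤ.+ l ℤ.* j) ≡ a ℚ.* ι (+ D ℤ.* i) ℚ.+ b ℚ.* ι (γ ℤ.* i ℤ.+ + h ℤ.* j)
      coordinate i j = begin
        ι (m ℤ.* i ℤ.+ l ℤ.* j)
          ≡⟨ ι-linear m l i j ⟩
        ι m ℚ.* ι i ℚ.+ ι l ℚ.* ι j
          ≡⟨ cong₂ (λ r s → r ℚ.* ι i ℚ.+ s ℚ.* ι j) am bl ⟨
        (a ℚ.* ι (+ D) ℚ.+ b ℚ.* ι γ) ℚ.* ι i ℚ.+ b ℚ.* ι (+ h) ℚ.* ι j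
          ≡⟨ regroup a b (ι (+ D)) (ι γ) (ι (+ h)) (ι i) (ι j) ⟩
        a ℚ.* (ι (+ D) ℚ.* ι i) ℚ.+ b ℚ.* (ι γ ℚ.* ι i ℚ.+ ι (+ h) ℚ.* ι j)
          ≡⟨ cong₂ (λ r s → a ℚ.* r ℚ.+ b ℚ.* s) (ι-* (+ D) i) (ι-linear γ (+ h) i j) ⟨
        a ℚ.* ι (+ D ℤ.* i) ℚ.+ b ℚ.* ι (γ ℤ.* i ℤ.+ + h ℤ.* j) ∎
        where
        open ℚ-Solver
        regroup : ∀ a b D γ h i j → (a ℚ.* D ℚ.+ b ℚ.* γ) ℚ.* i ℚ.+ b ℚ.* h ℚ.* j ≡ a ℚ.* (D ℚ.* i) ℚ.+ b ℚ.* (γ ℚ.* i ℚ.+ h ℚ.* j)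
        regroup = solve 7 (λ a b D γ h i j →
          (a :* D :+ b :* γ) :* i :+ b :* h :* j := a :* (D :* i) :+ b :* (γ :* i :+ h :* j)) refl

    module _ {a b p} (comb : IsComb a b u v p) where
      ι-k : a ℚ.* ι (+ D) ℚ.+ b ℚ.* ι γ ≡ ι (dot k p)
      ι-k = sym (trans (dot-isComb {a} {b} {u} {v} {p} comb k)
        (cong₂ (λ i j → a ℚ.* ι i ℚ.+ b ℚ.* ι j) (trans (cong (dot k) u≡point) (dot-k-point (+ D) 0ℤ))
                                                 (trans (cong (dot k) v≡) (dot-k-point γ (+ h)))))

      ι-k′ : b ℚ.* ι (+ h) ≡ ι (dot k′ p)
      ι-k′ = sym (trans (dot-isComb {a} {b} {u} {v} {p} comb k′)
        (trans (cong₂ (λ i j → a ℚ.* ι i ℚ.+ b ℚ.* ι j) (trans (cong (dot k′) u≡point) (dot-k′-point (+ D) 0ℤ))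
                                                        (trans (cong (dot k′) v≡) (dot-k′-point γ (+ h))))
          (trans (cong (ℚ._+ b ℚ.* ι (+ h)) (ℚ.*-zeroʳ a)) (ℚ.+-identityˡ (b ℚ.* ι (+ h))))))

      -- The point with these integer coordinates has the same rational coefficients a, b over (u,
      -- v) as p, and coefficients determine the point.
      span⇒point : p ≡ point (dot k p) (dot k′ p)
      span⇒point = isComb-functional {a} {b} {u} {v} comb (isComb-point a b (dot k p) (dot k′ p) ι-k ι-k′)

    private
      1/D 1/h : ℚ
      1/D = proj₁ (ι-inverse D)
      1/h = proj₁ (ι-inverse h)

    point-coefficients : ∀ m l → Σ ℚ λ a → Σ ℚ λ b →
      a ℚ.* ι (+ (D ℕ.* h)) ≡ ι (+ h ℤ.* m ℤ.- l ℤ.* γ) × b ℚ.* ι (+ h) ≡ ι l × IsComb a b u v (point m l)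
    point-coefficients m l = a , b , a-eq , b-eq , isComb-point a b m l m-eq b-eq
      where
      s : ℤ
      s = + h ℤ.* m ℤ.- l ℤ.* γ
      a b : ℚ
      -- Solution of the triangular system m = a D + b γ, l = b h.
      a = ι s ℚ.* (1/h ℚ.* 1/D)
      b = ι l ℚ.* 1/h
      open ℚ-Solver
      b-eq : b ℚ.* ι (+ h) ≡ ι l
      b-eq = trans (ℚ.*-assoc (ι l) 1/h (ι (+ h))) (trans (cong (ι l ℚ.*_) (proj₂ (ι-inverse h))) (ℚ.*-identityʳ (ι l)))
      a-eq : a ℚ.* ι (+ (D ℕ.* h)) ≡ ι s
      a-eq = begin
        a ℚ.* ι (+ (D ℕ.* h))                             ≡⟨ cong (a ℚ.*_) (trans (cong ι (ℤ.pos-* D h)) (ι-* (+ D) (+ h))) ⟩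
        a ℚ.* (ι (+ D) ℚ.* ι (+ h))                       ≡⟨ swap (ι s) 1/h 1/D (ι (+ D)) (ι (+ h)) ⟩
        ι s ℚ.* (1/h ℚ.* ι (+ h)) ℚ.* (1/D ℚ.* ι (+ D))   ≡⟨ cong₂ (λ i j → ι s ℚ.* i ℚ.* j) (proj₂ (ι-inverse h)) (proj₂ (ι-inverse D)) ⟩
        ι s ℚ.* ι 1ℤ ℚ.* ι 1ℤ                             ≡⟨ trans (ℚ.*-identityʳ (ι s ℚ.* ι 1ℤ)) (ℚ.*-identityʳ (ι s)) ⟩
        ι s                                               ∎
        where
        swap : ∀ s r r′ D h → s ℚ.* (r ℚ.* r′) ℚ.* (D ℚ.* h) ≡ s ℚ.* (r ℚ.* h) ℚ.* (r′ ℚ.* D)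
        swap = solve 5 (λ s r r′ D h → s :* (r :* r′) :* (D :* h) := s :* (r :* h) :* (r′ :* D)) refl
      m-eq : a ℚ.* ι (+ D) ℚ.+ b ℚ.* ι γ ≡ ι m
      m-eq = begin
        a ℚ.* ι (+ D) ℚ.+ b ℚ.* ι γ
          ≡⟨ pull (ι s) 1/h 1/D (ι (+ D)) (ι l) (ι γ) ⟩
        (ι s ℚ.* (1/D ℚ.* ι (+ D)) ℚ.+ ι l ℚ.* ι γ) ℚ.* 1/h
          ≡⟨ cong (λ i → (ι s ℚ.* i ℚ.+ ι l ℚ.* ι γ) ℚ.* 1/h) (proj₂ (ι-inverse D)) ⟩
        (ι s ℚ.* ι 1ℤ ℚ.+ ι l ℚ.* ι γ) ℚ.* 1/h
          ≡⟨ cong (ℚ._* 1/h) (trans (cong₂ ℚ._+_ (ℚ.*-identityʳ (ι s)) (sym (ι-* l γ))) (sym (ι-+ s (l ℤ.* γ)))) ⟩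
        ι (s ℤ.+ l ℤ.* γ) ℚ.* 1/h
          ≡⟨ cong (λ i → ι i ℚ.* 1/h) (i-j+j≡i (+ h ℤ.* m) (l ℤ.* γ)) ⟩
        ι (+ h ℤ.* m) ℚ.* 1/h
          ≡⟨ cong (ℚ._* 1/h) (ι-* (+ h) m) ⟩
        ι (+ h) ℚ.* ι m ℚ.* 1/h
          ≡⟨ rotate (ι (+ h)) (ι m) 1/h ⟩
        ι m ℚ.* (1/h ℚ.* ι (+ h))
          ≡⟨ trans (cong (ι m ℚ.*_) (proj₂ (ι-inverse h))) (ℚ.*-identityʳ (ι m)) ⟩
        ι m ∎
        where
        pull : ∀ s r r′ D l γ → s ℚ.* (r ℚ.* r′) ℚ.* D ℚ.+ l ℚ.* r ℚ.* γ ≡ (s ℚ.* (r′ ℚ.* D) ℚ.+ l ℚ.* γ) ℚ.* r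
        pull = solve 6 (λ s r r′ D l γ → s :* (r :* r′) :* D :+ l :* r :* γ := (s :* (r′ :* D) :+ l :* γ) :* r) refl
        rotate : ∀ h m r → h ℚ.* m ℚ.* r ≡ m ℚ.* (r ℚ.* h)
        rotate = solve 3 (λ h m r → h :* m :* r := m :* (r :* h)) refl

open RationalSpan

-- Counting integer points of a parallelogram in adapted coordinates.

module StripCount where
  open import Data.Integer using (_+_; _*_; -_; _-_)

  length-cartesianProduct : ∀ {A B : Set} (xs : List A) (ys : List B) →
    length (cartesianProduct xs ys) ≡ length xs ℕ.* length ys
  length-cartesianProduct [] ys = refl
  length-cartesianProduct (x ∷ xs) ys = trans (length-++ (map (x ,_) ys))
    (cong₂ ℕ._+_ (length-map (x ,_) ys) (length-cartesianProduct xs ys))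

  -- The preimage of the n-th dilate in the coordinates (m , l) of an adapted basis.
  InStrip : (D h : ℕ) (γ : ℤ) (n : ℕ) → ℤ × ℤ → Set
  InStrip D h γ n (m , l) =
    0ℤ ℤ.≤ l × l ℤ.≤ + n * + h × 0ℤ ℤ.≤ + h * m - l * γ × + h * m - l * γ ℤ.≤ + n * + (D ℕ.* h)

  -- Half-open lines: on each of the n h + 1 lines l = const there are n D points with
  -- 0 ≤ h m - l γ < n D h; the remaining points lie on the far edge h m - l γ = n D h, where
  -- k₂ ∣ l, which leaves n D₂ + 1 of them.
  module Strip (D h : ℕ) (γ : ℤ) (D₂ k₂ : ℕ) (γ′ X Y : ℤ) .{{_ : ℕ.NonZero D₂}} .{{_ : ℕ.NonZero k₂}} .{{_ : ℕ.NonZero h}}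
    (h≡ : h ≡ D₂ ℕ.* k₂) (γ≡ : γ ≡ + D₂ * γ′) (coprime : γ′ * X + + k₂ * Y ≡ 1ℤ) (n : ℕ) where

    q : ℕ → ℤ
    q l = (- (+ l * γ)) /ℕ h
    ρ : ℕ → ℕ
    ρ l = (- (+ l * γ)) %ℕ h

    -- Dividing `- l γ` by h with quotient `q l` and remainder `ρ l` gives h m - l γ = h (m + q l) +
    -- ρ l; the index i = m + q l therefore runs from 0 to n D - 1 on every line.
    inner : ℕ × ℕ → ℤ × ℤ
    inner (l , i) = + i - q l , + l

    -- In adapted coordinates n u is (n D, 0) and the primitive vector v / D₂ is (γ′, k₂); these are
    -- the points n u + j (v / D₂).
    edge : ℕ → ℤ × ℤ
    edge j = + j * γ′ + + n * + D , + (k₂ ℕ.* j)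

    -- This is `D * h` times the coefficient of u.
    height : ℤ × ℤ → ℤ
    height (m , l) = + h * m - l * γ

    +h≡ : + h ≡ + D₂ * + k₂
    +h≡ = trans (cong +_ h≡) (ℤ.pos-* D₂ k₂)

    top≡ : + n * + (D ℕ.* h) ≡ + h * (+ n * + D)
    top≡ = trans (cong (+ n *_) (ℤ.pos-* D h)) (rotate (+ n) (+ D) (+ h))
      where
      rotate : ∀ n D h → n * (D * h) ≡ h * (n * D)
      rotate = solve-∀

    height-shift : ∀ m l → + h * m - + l * γ ≡ + h * (m + q l) + + ρ l
    height-shift m l = trans (cong (_+_ (+ h * m)) (a≡a%ℕn+[a/ℕn]*n (- (+ l * γ)) h))
      (regroup (+ h) m (+ ρ l) (q l))
      where
      regroup : ∀ h m ρ q → h * m + (ρ + q * h) ≡ h * (m + q) + ρ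
      regroup = solve-∀

    height-inner : ∀ l i → height (inner (l , i)) ≡ + (h ℕ.* i ℕ.+ ρ l)
    height-inner l i = trans (height-shift (+ i - q l) l)
      (trans (cong (λ j → + h * j + + ρ l) (i-j+j≡i (+ i) (q l))) (cong (_+ + ρ l) (sym (ℤ.pos-* h i))))

    inner<top : ∀ l i → i ℕ.< n ℕ.* D → height (inner (l , i)) ℤ.< + n * + (D ℕ.* h)
    inner<top l i i<nD = subst₂ ℤ._<_ (sym (height-inner l i)) (trans (trans (ℤ.pos-* h (n ℕ.* D)) (cong (+ h *_) (ℤ.pos-* n D))) (sym top≡))
      (ℤ.+<+ (ℕ.<-≤-trans (ℕ.+-monoʳ-< (h ℕ.* i) (n%ℕd<d (- (+ l * γ)) h))
        (ℕ.≤-trans (ℕ.≤-reflexive (trans (ℕ.+-comm (h ℕ.* i) h) (sym (ℕ.*-suc h i)))) (ℕ.*-monoʳ-≤ h i<nD))))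

    height-edge : ∀ j → height (edge j) ≡ + n * + (D ℕ.* h)
    height-edge j = trans (cong₂ (λ k c → + h * (+ j * γ′ + + n * + D) - k * c) (ℤ.pos-* k₂ j) γ≡)
      (trans (cong (λ k → k * (+ j * γ′ + + n * + D) - + k₂ * + j * (+ D₂ * γ′)) +h≡)
        (trans (cancel (+ D₂) (+ k₂) (+ j) γ′ (+ n * + D)) (trans (cong (_* (+ n * + D)) (sym +h≡)) (sym top≡))))
      where
      cancel : ∀ d k j γ c → d * k * (j * γ + c) - k * j * (d * γ) ≡ d * k * c
      cancel = solve-∀

    lines : List (ℕ × ℕ)
    lines = cartesianProduct (upTo (suc (n ℕ.* h))) (upTo (n ℕ.* D))

    points : List (ℤ × ℤ)
    points = map inner lines ++ map edge (upTo (suc (n ℕ.* D₂)))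

    length-points : length points ≡ suc (n ℕ.* h) ℕ.* (n ℕ.* D) ℕ.+ suc (n ℕ.* D₂)
    length-points = trans (length-++ (map inner lines)) (cong₂ ℕ._+_
      (trans (length-map inner lines) (trans (length-cartesianProduct (upTo (suc (n ℕ.* h))) (upTo (n ℕ.* D)))
        (cong₂ ℕ._*_ (length-upTo (suc (n ℕ.* h))) (length-upTo (n ℕ.* D)))))
      (trans (length-map edge (upTo (suc (n ℕ.* D₂)))) (length-upTo (suc (n ℕ.* D₂)))))

    inner-injective : ∀ {a b} → inner a ≡ inner b → a ≡ b
    inner-injective {l , i} {l′ , i′} eq with ℤ.+-injective (cong proj₂ eq)
    ... | refl = cong (l ,_) (ℤ.+-injective
      (trans (sym (i-j+j≡i (+ i) (q l))) (trans (cong (λ p → proj₁ p + q l) eq) (i-j+j≡i (+ i′) (q l)))))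

    edge-injective : ∀ {a b} → edge a ≡ edge b → a ≡ b
    edge-injective {a} {b} eq = ℕ.*-cancelˡ-≡ a b k₂ (ℤ.+-injective (cong proj₂ eq))

    member-lines : ∀ {l i} → (l , i) ∈ lines → l ℕ.≤ n ℕ.* h × i ℕ.< n ℕ.* D
    member-lines li∈ with ∈-cartesianProduct⁻ (upTo (suc (n ℕ.* h))) (upTo (n ℕ.* D)) li∈
    ... | l∈ , i∈ = ℕ.≤-pred (∈-upTo⁻ l∈) , ∈-upTo⁻ i∈

    unique-points : Unique points
    unique-points = ++⁺ (map⁺ inner-injective (cartesianProduct⁺ (upTo⁺ (suc (n ℕ.* h))) (upTo⁺ (n ℕ.* D))))
                        (map⁺ edge-injective (upTo⁺ (suc (n ℕ.* D₂)))) disjoint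
      where
      -- The height separates the two lists: inner points lie strictly below the top value, edge
      -- points attain it.
      disjoint : ∀ {p} → ¬ (p ∈ map inner lines × p ∈ map edge (upTo (suc (n ℕ.* D₂))))
      disjoint (p∈inner , p∈edge) with ∈-map⁻ inner p∈inner | ∈-map⁻ edge p∈edge
      ... | (l , i) , li∈ , p≡inner | j , _ , p≡edge =
        ℤ.<-irrefl (trans (cong height (trans (sym p≡inner) p≡edge)) (height-edge j)) (inner<top l i (proj₂ (member-lines li∈)))

    points⇒strip : ∀ p → p ∈ points → InStrip D h γ n p
    points⇒strip p p∈ with ∈-++⁻ (map inner lines) p∈
    ... | inj₁ p∈inner with ∈-map⁻ inner p∈inner
    ...   | (l , i) , li∈ , refl =
      ℤ.+≤+ ℕ.z≤n , subst (+ l ℤ.≤_) (ℤ.pos-* n h) (ℤ.+≤+ (proj₁ (member-lines li∈))) ,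
      subst (0ℤ ℤ.≤_) (sym (height-inner l i)) (ℤ.+≤+ ℕ.z≤n) ,
      ℤ.<⇒≤ (inner<top l i (proj₂ (member-lines li∈)))
    points⇒strip p p∈ | inj₂ p∈edge with ∈-map⁻ edge p∈edge
    ...   | j , j∈ , refl =
      ℤ.+≤+ ℕ.z≤n , subst (+ (k₂ ℕ.* j) ℤ.≤_) (ℤ.pos-* n h) (ℤ.+≤+ k₂j≤nh) ,
      subst (0ℤ ℤ.≤_) (sym (trans (height-edge j) (sym (ℤ.pos-* n (D ℕ.* h))))) (ℤ.+≤+ ℕ.z≤n) ,
      ℤ.≤-reflexive (height-edge j)
      where
      k₂j≤nh : k₂ ℕ.* j ℕ.≤ n ℕ.* h
      k₂j≤nh = ℕ.≤-trans (ℕ.*-monoʳ-≤ k₂ (ℕ.≤-pred (∈-upTo⁻ j∈)))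
        (ℕ.≤-reflexive (trans (ℕ.*-comm k₂ (n ℕ.* D₂)) (trans (ℕ.*-assoc n D₂ k₂) (cong (n ℕ.*_) (sym h≡)))))

    below-top⇒points : ∀ m l → l ℕ.≤ n ℕ.* h → 0ℤ ℤ.≤ height (m , + l) → height (m , + l) ℤ.< + n * + (D ℕ.* h) →
      (m , + l) ∈ points
    below-top⇒points m l l≤nh nonneg bound = subst (_∈ points) (cong (_, + l) m≡)
      (∈-++⁺ˡ (∈-map⁺ inner (∈-cartesianProduct⁺ (∈-upTo⁺ (ℕ.s≤s l≤nh)) (∈-upTo⁺ i<nD))))
      where
      bounds : 0ℤ ℤ.≤ m + q l × m + q l ℤ.< + n * + D
      bounds = quotient-bounds h (ρ l) (m + q l) (+ n * + D) (n%ℕd<d (- (+ l * γ)) h)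
        (subst (0ℤ ℤ.≤_) (height-shift m l) nonneg) (subst₂ ℤ._<_ (height-shift m l) top≡ bound)
      i≡ : + ∣ m + q l ∣ ≡ m + q l
      i≡ = ℤ.0≤i⇒+∣i∣≡i (proj₁ bounds)
      i<nD : ∣ m + q l ∣ ℕ.< n ℕ.* D
      i<nD = ℤ.drop‿+<+ (subst₂ ℤ._<_ (sym i≡) (sym (ℤ.pos-* n D)) (proj₂ bounds))
      m≡ : + ∣ m + q l ∣ - q l ≡ m
      m≡ = trans (cong (_- q l) i≡) (cancel m (q l))
        where
        cancel : ∀ m q → m + q - q ≡ m
        cancel = solve-∀

    -- On the far edge D₂ cancels and leaves k₂ (m - n D) = l γ′. Since γ′ and k₂ are coprime, k₂
    -- divides l, and j is the quotient.
    top⇒points : ∀ m l → l ℕ.≤ n ℕ.* h → height (m , + l) ≡ + n * + (D ℕ.* h) → (m , + l) ∈ points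
    top⇒points m l l≤nh top = subst (_∈ points) (cong₂ _,_ m≡ (sym l≡))
      (∈-++⁺ʳ (map inner lines) (∈-map⁺ edge (∈-upTo⁺ (ℕ.s≤s j≤nD₂))))
      where
      r : ℤ
      r = m - + n * + D
      k₂r≡lγ′ : + k₂ * r ≡ + l * γ′
      k₂r≡lγ′ = ℤ.*-cancelˡ-≡ (+ D₂) (+ k₂ * r) (+ l * γ′) (begin
        + D₂ * (+ k₂ * (m - + n * + D))                          ≡⟨ expand (+ D₂) (+ k₂) m (+ n * + D) (+ l) γ′ ⟩
        (+ D₂ * + k₂ * m - + l * (+ D₂ * γ′)) - + D₂ * + k₂ * (+ n * + D) + + D₂ * (+ l * γ′)
          ≡⟨ cong₂ (λ a b → (a * m - + l * b) - a * (+ n * + D) + + D₂ * (+ l * γ′)) +h≡ γ≡ ⟨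
        height (m , + l) - + h * (+ n * + D) + + D₂ * (+ l * γ′)
          ≡⟨ cong (λ a → a - + h * (+ n * + D) + + D₂ * (+ l * γ′)) (trans top top≡) ⟩
        + h * (+ n * + D) - + h * (+ n * + D) + + D₂ * (+ l * γ′)
          ≡⟨ cancel (+ h * (+ n * + D)) (+ D₂ * (+ l * γ′)) ⟩
        + D₂ * (+ l * γ′) ∎)
        where
        expand : ∀ d k m c l γ → d * (k * (m - c)) ≡ (d * k * m - l * (d * γ)) - d * k * c + d * (l * γ)
        expand = solve-∀
        cancel : ∀ a b → a - a + b ≡ b
        cancel = solve-∀
      k₂∣l : k₂ ℕ.∣ l
      k₂∣l = ∣⇒∣ᵤ {+ k₂} {+ l} (divides (r * X + + l * Y) (begin
        + l                                  ≡⟨ ℤ.*-identityʳ (+ l) ⟨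
        + l * 1ℤ                             ≡⟨ cong (+ l *_) coprime ⟨
        + l * (γ′ * X + + k₂ * Y)            ≡⟨ distribute (+ l) γ′ X (+ k₂) Y ⟩
        + l * γ′ * X + + k₂ * (+ l * Y)      ≡⟨ cong (λ a → a * X + + k₂ * (+ l * Y)) k₂r≡lγ′ ⟨
        + k₂ * r * X + + k₂ * (+ l * Y)      ≡⟨ factor (+ k₂) r X (+ l) Y ⟩
        (r * X + + l * Y) * + k₂             ∎))
        where
        distribute : ∀ l γ X k Y → l * (γ * X + k * Y) ≡ l * γ * X + k * (l * Y)
        distribute = solve-∀
        factor : ∀ k r X l Y → k * r * X + k * (l * Y) ≡ (r * X + l * Y) * k
        factor = solve-∀
      j : ℕ
      j = ℕ.quotient k₂∣l
      lℕ≡ : l ≡ k₂ ℕ.* j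
      lℕ≡ = trans (ℕ._∣_.equality k₂∣l) (ℕ.*-comm j k₂)
      l≡ : + l ≡ + (k₂ ℕ.* j)
      l≡ = cong +_ lℕ≡
      j≤nD₂ : j ℕ.≤ n ℕ.* D₂
      j≤nD₂ = ℕ.*-cancelˡ-≤ k₂ (subst₂ ℕ._≤_ lℕ≡
        (trans (cong (n ℕ.*_) h≡) (trans (sym (ℕ.*-assoc n D₂ k₂)) (ℕ.*-comm (n ℕ.* D₂) k₂))) l≤nh)
      r≡ : r ≡ + j * γ′
      r≡ = ℤ.*-cancelˡ-≡ (+ k₂) r (+ j * γ′) (trans k₂r≡lγ′ (trans (cong (_* γ′) (trans l≡ (ℤ.pos-* k₂ j))) (ℤ.*-assoc (+ k₂) (+ j) γ′)))
      m≡ : + j * γ′ + + n * + D ≡ m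
      m≡ = trans (cong (_+ + n * + D) (sym r≡)) (i-j+j≡i m (+ n * + D))

    strip⇒points : ∀ p → InStrip D h γ n p → p ∈ points
    strip⇒points (m , + l) (_ , l≤nh , nonneg , bound) with height (m , + l) ℤ.≟ + n * + (D ℕ.* h)
    ... | yes top = top⇒points m l (ℤ.drop‿+≤+ (subst (+ l ℤ.≤_) (sym (ℤ.pos-* n h)) l≤nh)) top
    ... | no ¬top = below-top⇒points m l (ℤ.drop‿+≤+ (subst (+ l ℤ.≤_) (sym (ℤ.pos-* n h)) l≤nh)) nonneg
                      (ℤ.≤∧≢⇒< bound ¬top)

open StripCount

-- From the adapted basis to covolume and point count.

module LatticePoints where
  open import Data.Integer using (_+_; _*_; -_; _-_)

  module Lattice {u v : ℍ} {D h : ℕ} {{_ : ℕ.NonZero D}} {{_ : ℕ.NonZero h}} (basis : AdaptedBasis u v D h) where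
    open Plane basis

    -- The sublattice spanned by u and v has index D h, so its Gram determinant is (D h)² times that
    -- of the basis (u′, w), and the square cancels.
    covolume : ∀ A → gram u v ≡ + (D ℕ.* h) * + (D ℕ.* h) * + (A ℕ.* A) → CovolumeIs u v A
    covolume A gram≡ = u′ , w , subst (InSpan u v) point-1-0 (point-inSpan 1ℤ 0ℤ) , subst (InSpan u v) point-0-1 (point-inSpan 0ℤ 1ℤ) ,
      (λ p (a , b , comb) → dot k p , dot k′ p ,
        subst (IsComb (ι (dot k p)) (ι (dot k′ p)) u′ w) (sym (span⇒point {a} {b} {p} comb)) (isComb-⊕ (dot k p) (dot k′ p) u′ w)) ,
      ℤ.*-cancelˡ-≡ (+ (D ℕ.* h) * + (D ℕ.* h)) (gram u′ w) (+ (A ℕ.* A)) {{≢0}} (begin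
        + (D ℕ.* h) * + (D ℕ.* h) * gram u′ w        ≡⟨ cong (λ g → g * g * gram u′ w) (ℤ.pos-* D h) ⟩
        (+ D * + h) * (+ D * + h) * gram u′ w        ≡⟨ gram-triangular (+ D) γ (+ h) u′ w ⟨
        gram ((+ D) • u′) (γ • u′ ⊕ (+ h) • w)       ≡⟨ cong₂ gram u≡ v≡ ⟨
        gram u v                                     ≡⟨ gram≡ ⟩
        + (D ℕ.* h) * + (D ℕ.* h) * + (A ℕ.* A)      ∎)
      where
      point-inSpan : ∀ m l → InSpan u v (point m l)
      point-inSpan m l = let a , b , _ , _ , comb = point-coefficients m l in a , b , comb
      point-1-0 : point 1ℤ 0ℤ ≡ u′
      point-1-0 = proveℍ (env 0ℤ 0ℤ u′ w u′) (con 1ℤ •ₚ pₚ ⊕ₚ con 0ℤ •ₚ qₚ) pₚ refl refl refl refl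
        where open ℤ-Solver using (con)
      point-0-1 : point 0ℤ 1ℤ ≡ w
      point-0-1 = proveℍ (env 0ℤ 0ℤ u′ w u′) (con 0ℤ •ₚ pₚ ⊕ₚ con 1ℤ •ₚ qₚ) qₚ refl refl refl refl
        where open ℤ-Solver using (con)
      ≢0 : ℤ.NonZero (+ (D ℕ.* h) * + (D ℕ.* h))
      ≢0 = subst ℤ.NonZero (ℤ.pos-* (D ℕ.* h) (D ℕ.* h)) (ℕ.m*n≢0 (D ℕ.* h) (D ℕ.* h) {{ℕ.m*n≢0 D h}} {{ℕ.m*n≢0 D h}})

    point-injective : ∀ {p q} → point (proj₁ p) (proj₂ p) ≡ point (proj₁ q) (proj₂ q) → p ≡ q
    point-injective {m , l} {m′ , l′} eq = cong₂ _,_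
      (trans (sym (dot-k-point m l)) (trans (cong (dot k) eq) (dot-k-point m′ l′)))
      (trans (sym (dot-k′-point m l)) (trans (cong (dot k′) eq) (dot-k′-point m′ l′)))

    -- Eliminating b from m = a D + b γ and l = b h gives a D h = h m - l γ, so both bounds on a and
    -- b are bounds on integers.
    dilate⇒strip : ∀ n p → InDilate n u v p → InStrip D h γ n (dot k p , dot k′ p)
    dilate⇒strip n p (a , b , 0≤a , a≤n , 0≤b , b≤n , comb) = proj₁ l-bounds , proj₂ l-bounds , s-bounds
      where
      m l : ℤ
      m = dot k p
      l = dot k′ p
      s≡ : a ℚ.* ι (+ (D ℕ.* h)) ≡ ι (+ h * m - l * γ)
      s≡ = sym (begin
        ι (+ h * m - l * γ)
          ≡⟨ ι-+ (+ h * m) (- (l * γ)) ⟩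
        ι (+ h * m) ℚ.+ ι (- (l * γ))
          ≡⟨ cong₂ ℚ._+_ (ι-* (+ h) m) (trans (ι-neg (l * γ)) (cong ℚ.-_ (ι-* l γ))) ⟩
        ι (+ h) ℚ.* ι m ℚ.- ι l ℚ.* ι γ
          ≡⟨ cong₂ (λ i j → ι (+ h) ℚ.* i ℚ.- j ℚ.* ι γ) (ι-k {a} {b} {p} comb) (ι-k′ {a} {b} {p} comb) ⟨
        ι (+ h) ℚ.* (a ℚ.* ι (+ D) ℚ.+ b ℚ.* ι γ) ℚ.- b ℚ.* ι (+ h) ℚ.* ι γ
          ≡⟨ cancel a b (ι (+ D)) (ι γ) (ι (+ h)) ⟩
        a ℚ.* (ι (+ D) ℚ.* ι (+ h))
          ≡⟨ cong (a ℚ.*_) (trans (cong ι (ℤ.pos-* D h)) (ι-* (+ D) (+ h))) ⟨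
        a ℚ.* ι (+ (D ℕ.* h)) ∎)
        where
        open ℚ-Solver
        cancel : ∀ a b D γ h → h ℚ.* (a ℚ.* D ℚ.+ b ℚ.* γ) ℚ.- b ℚ.* h ℚ.* γ ≡ a ℚ.* (D ℚ.* h)
        cancel = solve 5 (λ a b D γ h → h :* (a :* D :+ b :* γ) :- b :* h :* γ := a :* (D :* h)) refl
      l-bounds : 0ℤ ℤ.≤ l × l ℤ.≤ + n * + h
      l-bounds = clear-denominator {b} {l} n h (ι-k′ {a} {b} {p} comb) 0≤b b≤n
      s-bounds : 0ℤ ℤ.≤ + h * m - l * γ × + h * m - l * γ ℤ.≤ + n * + (D ℕ.* h)
      s-bounds = clear-denominator {a} {+ h * m - l * γ} n (D ℕ.* h) {{ℕ.m*n≢0 D h}} s≡ 0≤a a≤n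

    strip⇒dilate : ∀ n m l → InStrip D h γ n (m , l) → InDilate n u v (point m l)
    strip⇒dilate n m l (0≤l , l≤nh , 0≤s , s≤nDh) =
      let a , b , a≡ , b≡ , comb = point-coefficients m l
          0≤a , a≤n = restore-denominator {a} {+ h * m - l * γ} n (D ℕ.* h) {{ℕ.m*n≢0 D h}} a≡ 0≤s s≤nDh
          0≤b , b≤n = restore-denominator {b} {l} n h b≡ 0≤l l≤nh
      in a , b , 0≤a , a≤n , 0≤b , b≤n , comb

    private
      D₂ : ℕ
      D₂ = gcd4 v
      v′ κ : ℍ
      v′ = proj₁ (gcd4-factor v)
      κ = proj₁ (gcd4-bézout v)

      dot-v : ∀ p → dot p v ≡ γ * dot p u′ + + h * dot p w
      dot-v p = trans (cong (dot p) v≡) (dot-⊕• γ (+ h) p u′ w)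

      dot-v′ : ∀ p → dot p v ≡ + D₂ * dot p v′
      dot-v′ p = trans (cong (dot p) (proj₂ (gcd4-factor v))) (dot-• (+ D₂) p v′)

      -- γ and h are the values on v of the integral functionals `dot k` and `dot k′`, so the
      -- content of v divides both.
      γ≡ : γ ≡ + D₂ * dot k v′
      γ≡ = trans (sym (dot-k-point γ (+ h))) (trans (cong (dot k) (sym v≡)) (dot-v′ k))

      h≡ : + h ≡ + D₂ * dot k′ v′
      h≡ = trans (sym (dot-k′-point γ (+ h))) (trans (cong (dot k′) (sym v≡)) (dot-v′ k′))

      D₂∣h : D₂ ℕ.∣ h
      D₂∣h = ∣⇒∣ᵤ {+ D₂} {+ h} (divides (dot k′ v′) (trans h≡ (ℤ.*-comm (+ D₂) (dot k′ v′))))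

      k₂ : ℕ
      k₂ = ℕ.quotient D₂∣h

      hℕ≡ : h ≡ D₂ ℕ.* k₂
      hℕ≡ = trans (ℕ._∣_.equality D₂∣h) (ℕ.*-comm k₂ D₂)

      D₂k₂≢0 : ℕ.NonZero (D₂ ℕ.* k₂)
      D₂k₂≢0 = ℕ.≢-nonZero (λ eq → ℕ.≢-nonZero⁻¹ h (trans hℕ≡ eq))

      instance
        D₂≢0 : ℕ.NonZero D₂
        D₂≢0 = ℕ.m*n≢0⇒m≢0 D₂ {{D₂k₂≢0}}
        k₂≢0 : ℕ.NonZero k₂
        k₂≢0 = ℕ.m*n≢0⇒n≢0 D₂ {{D₂k₂≢0}}

      -- A functional that attains the content of v writes D₂ as a combination of γ and h. So the
      -- content of v is the gcd of its coordinates, and dividing by D₂ gives the relation.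
      coprime : dot k v′ * dot κ u′ + + k₂ * dot κ w ≡ 1ℤ
      coprime = ℤ.*-cancelˡ-≡ (+ D₂) (dot k v′ * dot κ u′ + + k₂ * dot κ w) 1ℤ (begin
        + D₂ * (dot k v′ * dot κ u′ + + k₂ * dot κ w)        ≡⟨ distribute (+ D₂) (dot k v′) (dot κ u′) (+ k₂) (dot κ w) ⟩
        + D₂ * dot k v′ * dot κ u′ + + D₂ * + k₂ * dot κ w   ≡⟨ cong₂ (λ i j → i * dot κ u′ + j * dot κ w) γ≡ (trans (cong +_ hℕ≡) (ℤ.pos-* D₂ k₂)) ⟨
        γ * dot κ u′ + + h * dot κ w                         ≡⟨ dot-v κ ⟨
        dot κ v                                              ≡⟨ proj₂ (gcd4-bézout v) ⟩
        + D₂                                                 ≡⟨ ℤ.*-identityʳ (+ D₂) ⟨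
        + D₂ * 1ℤ                                            ∎)
        where
        distribute : ∀ d g X k Y → d * (g * X + k * Y) ≡ d * g * X + d * k * Y
        distribute = solve-∀

    count : ∀ n → CountIs (InDilate n u v) (D ℕ.* h ℕ.* n ℕ.* n ℕ.+ (D ℕ.+ gcd4 v) ℕ.* n ℕ.+ 1)
    count n = map point′ points , map⁺ point-injective unique-points , sound , complete ,
      trans (length-map point′ points) (trans length-points (total n h D D₂))
      where
      open Strip D h γ D₂ k₂ (dot k v′) (dot κ u′) (dot κ w) hℕ≡ γ≡ coprime n
        using (points; length-points; unique-points; points⇒strip; strip⇒points)
      point′ : ℤ × ℤ → ℍ
      point′ (m , l) = point m l
      sound : ∀ p → p ∈ map point′ points → InDilate n u v p
      sound p p∈ =
        let ml , ml∈ , p≡ = ∈-map⁻ point′ p∈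
        in subst (InDilate n u v) (sym p≡) (strip⇒dilate n (proj₁ ml) (proj₂ ml) (points⇒strip ml ml∈))
      complete : ∀ p → InDilate n u v p → p ∈ map point′ points
      complete p dilate@(a , b , _ , _ , _ , _ , comb) = subst (_∈ map point′ points) (sym (span⇒point {a} {b} {p} comb))
        (∈-map⁺ point′ (strip⇒points (dot k p , dot k′ p) (dilate⇒strip n p dilate)))
      total : ∀ n h D D₂ → suc (n ℕ.* h) ℕ.* (n ℕ.* D) ℕ.+ suc (n ℕ.* D₂) ≡ D ℕ.* h ℕ.* n ℕ.* n ℕ.+ (D ℕ.+ D₂) ℕ.* n ℕ.+ 1
      total = ℕ.solve-∀

  -- Left multiplication by q₁ and right multiplication by the conjugate of q₂ scale inner products
  -- by N q₁ and N q₂. Hence u and v inherit orthogonality and equal length from j and k.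
  dot-conjugate : ∀ q₁ q₂ a b → dot (q₁ · a · conj q₂) (q₁ · b · conj q₂) ≡ + N q₁ * + N q₂ * dot a b
  dot-conjugate q₁ q₂ a b = begin
    dot (q₁ · a · conj q₂) (q₁ · b · conj q₂)   ≡⟨ dot-·ʳ (q₁ · a) (q₁ · b) (conj q₂) ⟩
    nsq (conj q₂) * dot (q₁ · a) (q₁ · b)       ≡⟨ cong₂ _*_ (trans (nsq-conj q₂) (nsq≡N q₂)) (trans (dot-·ˡ q₁ a b) (cong (_* dot a b) (nsq≡N q₁))) ⟩
    + N q₂ * (+ N q₁ * dot a b)                 ≡⟨ rotate (+ N q₂) (+ N q₁) (dot a b) ⟩
    + N q₁ * + N q₂ * dot a b                   ∎
    where
    rotate : ∀ n₂ n₁ k → n₂ * (n₁ * k) ≡ n₁ * n₂ * k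
    rotate = solve-∀

  gram-conjugate : ∀ q₁ q₂ → gram (q₁ · qj · conj q₂) (q₁ · qk · conj q₂) ≡ (+ N q₁ * + N q₂) * (+ N q₁ * + N q₂)
  gram-conjugate q₁ q₂ = begin
    gram (q₁ · qj · conj q₂) (q₁ · qk · conj q₂)
      ≡⟨ cong₂ _-_ (cong₂ _*_ (dot-conjugate q₁ q₂ qj qj) (dot-conjugate q₁ q₂ qk qk))
                   (cong₂ _*_ (dot-conjugate q₁ q₂ qj qk) (dot-conjugate q₁ q₂ qj qk)) ⟩
    n * 1ℤ * (n * 1ℤ) - n * 0ℤ * (n * 0ℤ)
      ≡⟨ simplify n ⟩
    n * n ∎
    where
    n : ℤ
    n = + N q₁ * + N q₂
    simplify : ∀ n → n * 1ℤ * (n * 1ℤ) - n * 0ℤ * (n * 0ℤ) ≡ n * n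
    simplify = solve-∀

  odd⇒≢0 : ∀ q → Odd q → N q ≢ 0
  odd⇒≢0 q odd N≡0 = odd (subst (2 ℕ.∣_) (sym N≡0) (2 ℕ.∣0))

  -- Here g is a variable, so matching its factorisation with `refl` rewrites the leading
  -- coefficient and the Gram hypothesis together.
  adaptedBasis⇒covolume×count : ∀ {u v g D h} → ℕ.NonZero D → ℕ.NonZero h → g ≡ D ℕ.* h → AdaptedBasis u v D h →
    ∀ A → gram u v ≡ + g * + g * + (A ℕ.* A) →
    CovolumeIs u v A × (∀ n → CountIs (InDilate n u v) (g ℕ.* n ℕ.* n ℕ.+ (D ℕ.+ gcd4 v) ℕ.* n ℕ.+ 1))
  adaptedBasis⇒covolume×count D≢0 h≢0 refl basis A gram≡ = covolume A gram≡ , count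
    where open Lattice {{D≢0}} {{h≢0}} basis using (covolume; count)

  frame⇒covolume×count : ∀ {u v g} → ℕ.NonZero g → Frame u v g → ∀ A → gram u v ≡ + g * + g * + (A ℕ.* A) →
    CovolumeIs u v A × (∀ n → CountIs (InDilate n u v) (g ℕ.* n ℕ.* n ℕ.+ (gcd4 u ℕ.+ gcd4 v) ℕ.* n ℕ.+ 1))
  frame⇒covolume×count g≢0 frame A gram≡ =
    let h , D≢0 , h≢0 , g≡Dh , basis = frame⇒adaptedBasis {{g≢0}} frame
    in adaptedBasis⇒covolume×count D≢0 h≢0 g≡Dh basis A gram≡

open LatticePoints

-- The covolume and Ehrhart polynomial of the square.

open import Data.Nat using (_+_; _*_; _<_)

theorem2p12 : (q₁ q₂ : ℍ) → Odd q₁ → Odd q₂ →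
  (∀ (α β : ℤ) → ℤ.+ 1 ℤ.< α ℤ.* α ℤ.+ β ℤ.* β → ¬ RightDivisible q₁ (cplx α β)) →
  (∀ (α β : ℤ) → ℤ.+ 1 ℤ.< α ℤ.* α ℤ.+ β ℤ.* β → ¬ RightDivisible q₂ (cplx α β)) →
  let u = q₁ · qj · conj q₂
      v = q₁ · qk · conj q₂
  in CovolumeIs u v (lcm (N q₁) (N q₂)) ×
     (∀ (n : ℕ) → 0 < n →
        CountIs (InDilate n u v) (gcd (N q₁) (N q₂) * n * n + (gcd4 u + gcd4 v) * n + 1))
theorem2p12 q₁ q₂ odd₁ odd₂ indivisible₁ indivisible₂ = covolume , λ n _ → count n
  where
  g≢0 : ℕ.NonZero (gcd (N q₁) (N q₂))
  g≢0 = ℕ.≢-nonZero (gcd[m,n]≢0 (N q₁) (N q₂) (inj₁ (odd⇒≢0 q₁ odd₁)))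
  gram≡ : gram (q₁ · qj · conj q₂) (q₁ · qk · conj q₂) ≡
    + gcd (N q₁) (N q₂) ℤ.* + gcd (N q₁) (N q₂) ℤ.* + (lcm (N q₁) (N q₂) * lcm (N q₁) (N q₂))
  gram≡ = trans (gram-conjugate q₁ q₂) (gcd²*lcm² (N q₁) (N q₂))
  conclusion = frame⇒covolume×count g≢0
    (frame q₁ q₂ odd₁ (complexPrimitive q₁ odd₁ indivisible₁) (complexPrimitive q₂ odd₂ indivisible₂))
    (lcm (N q₁) (N q₂)) gram≡
  covolume = proj₁ conclusion
  count = proj₂ conclusion
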